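{- For every $v\equiv 0 \pmod 6$ with $v\ge 18$, there exists a $2$-split decomposition of $K_v^{(3)}-I$ into tight $9$-cycles.
   Context: $K_v^{(3)}$ denotes the complete $3$-uniform hypergraph on $v$ vertices; for $3\mid v$, $K_v^{(3)}-I$ is obtained by deleting the edges of a $1$-factor $I$ (a set of $v/3$ pairwise disjoint triples covering all vertices). A (3-uniform tight) $k$-cycle is given by a cyclic sequence $v_1,\dots,v_k$ of $k$ distinct vertices, its edges being the triples $\{v_i,v_{i+1},v_{i+2}\}$ ($i=1,\dots,k$, indices mod $k$). A decomposition is a collection of cycles whose edge sets partition the edge set. For even $v$ with $3\mid v/2$, a $2$-split decomposition of $K_v^{(3)}-I$ into $k$-cycles is one where the vertex set is partitioned into two sets $V_1,V_2$ of size $v/2$, the $1$-factor is $I=I_1\cup I_2$ with $I_j$ a $1$-factor of $V_j$, and the collection of cycles consists of a $k$-cycle decomposition of $K^{(3)}[V_1]-I_1$, a $k$-cycle decomposition of $K^{(3)}[V_2]-I_2$, and a $k$-cycle decomposition of the hypergraph of all triples meeting both $V_1$ and $V_2$. -}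

module Defs where

open import Level using (0ℓ)
open import Data.Nat using (ℕ; _+_; _*_; _/_; NonZero)
open import Data.Nat.DivMod using (_mod_)
open import Data.Fin using (Fin; toℕ)
open import Data.Fin.Subset using (Subset; ∣_∣; ⊤; ⊥; ⁅_⁆; _∪_; _∩_; _∈_; _⊆_; Nonempty; Empty)
open import Data.List using (List; length; _++_)
open import Data.List.Relation.Unary.All using (All)
open import Data.List.Relation.Unary.Any using (Any)
open import Data.List.Relation.Unary.AllPairs using (AllPairs)
import Data.List.Membership.Propositional as List
open import Data.List.Relation.Binary.Permutation.Propositional using (_↭_)
open import Data.Vec using (Vec; lookup)
open import Data.Vec.Relation.Unary.Unique.Propositional using (Unique)
open import Data.Product using (_×_; ∃-syntax)
open import Relation.Nullary using (¬_)
open import Relation.Unary using (Pred)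
open import Relation.Binary.PropositionalEquality using (_≡_)

-- A hypergraph on the vertex set Fin n is identified with its edge set.
Hypergraph : ℕ → Set₁
Hypergraph n = Pred (Subset n) 0ℓ

K³[_] : ∀ {n} → Subset n → Hypergraph n
K³[ V ] e = e ⊆ V × ∣ e ∣ ≡ 3

_∖_ : ∀ {n} → Hypergraph n → List (Subset n) → Hypergraph n
(H ∖ I) e = H e × ¬ (e List.∈ I)

Crossing : ∀ {n} → Subset n → Subset n → Hypergraph n
Crossing V₁ V₂ e = ∣ e ∣ ≡ 3 × Nonempty (e ∩ V₁) × Nonempty (e ∩ V₂)

-- The finite set I is given as a list; pairwise disjointness of its (nonempty)
-- members rules out repetitions.
record IsOneFactor {n} (V : Subset n) (I : List (Subset n)) : Set where
  field
    triples  : All K³[ V ] I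
    size     : length I * 3 ≡ ∣ V ∣
    disjoint : AllPairs (λ e f → Empty (e ∩ f)) I
    covers   : ∀ x → x ∈ V → Any (x ∈_) I

record TightCycle (k n : ℕ) : Set where
  field
    vertices : Vec (Fin n) k
    distinct : Unique vertices

module _ {k n : ℕ} .{{_ : NonZero k}} where

  cycleEdge : TightCycle k n → Fin k → Subset n
  cycleEdge C i = ⁅ at 0 ⁆ ∪ ⁅ at 1 ⁆ ∪ ⁅ at 2 ⁆
    where
    at : ℕ → Fin n
    at j = lookup (TightCycle.vertices C) ((toℕ i + j) mod k)

  edges : TightCycle k n → Hypergraph n
  edges C e = ∃[ i ] e ≡ cycleEdge C i

  record IsDecomposition (H : Hypergraph n) (Cs : List (TightCycle k n)) : Set where
    field
      within   : All (λ C → ∀ e → edges C e → H e) Cs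
      disjoint : AllPairs (λ C D → ∀ e → ¬ (edges C e × edges D e)) Cs
      covers   : ∀ e → H e → Any (λ C → edges C e) Cs

  -- Lists stand for finite collections, hence are compared up to reordering.
  -- The size conditions force n to be even, and the 1-factors force 3 ∣ n / 2.
  record IsTwoSplit (I : List (Subset n)) (Cs : List (TightCycle k n)) : Set where
    field
      V₁ V₂       : Subset n
      V-cover     : V₁ ∪ V₂ ≡ ⊤
      V-disjoint  : V₁ ∩ V₂ ≡ ⊥
      V₁-size     : ∣ V₁ ∣ ≡ n / 2
      V₂-size     : ∣ V₂ ∣ ≡ n / 2
      I₁ I₂       : List (Subset n)
      I₁-factor   : IsOneFactor V₁ I₁
      I₂-factor   : IsOneFactor V₂ I₂
      I-split     : I ↭ I₁ ++ I₂
      Cs₁ Cs₂ Cs₁₂ : List (TightCycle k n)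
      Cs₁-decomp  : IsDecomposition (K³[ V₁ ] ∖ I₁) Cs₁
      Cs₂-decomp  : IsDecomposition (K³[ V₂ ] ∖ I₂) Cs₂
      Cs₁₂-decomp : IsDecomposition (Crossing V₁ V₂) Cs₁₂
      Cs-split    : Cs ↭ Cs₁ ++ Cs₂ ++ Cs₁₂

record TwoSplitDecomposition (k v : ℕ) .{{_ : NonZero k}} : Set where
  field
    I         : List (Subset v)
    I-factor  : IsOneFactor ⊤ I
    cycles    : List (TightCycle k v)
    decomp    : IsDecomposition (K³[ ⊤ ] ∖ I) cycles
    two-split : IsTwoSplit I cycles

{-# OPTIONS --safe #-}

-- For disjoint vertex sets whose sizes are multiples of 3, write W(A) for K³[A] minus a 1-factor, X(A,B) for the
-- triples crossing A and B, and T(A,B,C) for the triples meeting A, B and C. These satisfy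
--   T(A ∪ A′,B,C) = T(A,B,C) + T(A′,B,C),
--   X(A ∪ A′,B)   = X(A,B) + X(A′,B) + T(A,A′,B),
--   W(A ∪ B)      = W(A) + W(B) + X(A,B),
-- so decompositions of all of them into tight 9-cycles follow from T on 3+3+3 vertices, X on 6+6, 6+9 and 9+9
-- vertices and W on 9, 12 and 15 vertices; these are given explicitly, most as orbits of a few base cycles.
module Submission where

open import Defs
open import Data.Nat using (ℕ; _≤_; _%_)
open import Relation.Binary.PropositionalEquality using (_≡_)

open import Data.Bool using (if_then_else_; not)
open import Data.Empty using (⊥-elim)
import Data.Empty as Empty
open import Data.Fin using (Fin; zero; suc; toℕ)
import Data.Fin.Properties as Fin
open import Data.Fin.Subset using (Subset; Side; inside; outside; _∈_; _⊆_; ⊤; ⊥; ∁; _∩_; _∪_; ⋃; ⁅_⁆; ∣_∣; Nonempty; Empty)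
open import Data.Fin.Subset.Properties
open import Data.List as List using (List; []; _∷_; _++_; length; concatMap; mapMaybe; iterate; replicate)
open import Data.List.Membership.Propositional using () renaming (_∈_ to _∈ₗ_)
open import Data.List.Membership.Propositional.Properties using (∈-++⁺ˡ; ∈-++⁺ʳ; ∈-++⁻; ∈-tabulate⁺; ∈-tabulate⁻)
open import Data.List.Properties using (map-cong; map-∘; length-++)
open import Data.List.Relation.Binary.Permutation.Propositional using (↭-refl)
open import Data.List.Relation.Unary.All as All using (All; []; _∷_)
import Data.List.Relation.Unary.All.Properties as Allₚ
open import Data.List.Relation.Unary.AllPairs as AllPairs using (AllPairs; []; _∷_)
import Data.List.Relation.Unary.AllPairs.Properties as AllPairsₚ
open import Data.List.Relation.Unary.Any as Any using (Any; here; there)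
import Data.List.Relation.Unary.Any.Properties as Anyₚ
open import Data.Maybe as Maybe using (Maybe)
open import Data.Nat as ℕ using (zero; suc; _+_; _*_; _/_; z≤n; s≤s; NonZero)
open import Data.Nat.DivMod using (_mod_; m≡m%n+[m/n]*n; m*n/n≡m; /-monoˡ-≤)
open import Data.Nat.ListAction using (sum)
import Data.Nat.Properties as ℕ
open import Data.Nat.Tactic.RingSolver using (solve-∀)
open import Data.Product using (∃; ∃₂; Σ-syntax; _×_; _,_; proj₁; proj₂)
open import Data.Sum using (_⊎_; inj₁; inj₂; [_,_]′)
open import Data.Unit using (tt)
open import Data.Vec as Vec using (Vec; []; _∷_; lookup; here; there)
open import Data.Vec.Membership.Propositional using () renaming (_∈_ to _∈ᵥ_)
open import Data.Vec.Membership.Propositional.Properties using () renaming (∈-map⁺ to ∈ᵥ-map⁺; ∈-++⁺ˡ to ∈ᵥ-++⁺ˡ; ∈-++⁺ʳ to ∈ᵥ-++⁺ʳ)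
import Data.Vec.Properties as Vecₚ
open import Data.Vec.Relation.Unary.All as VAll using ([]; _∷_)
import Data.Vec.Relation.Unary.All.Properties as VAllₚ
open import Data.Vec.Relation.Unary.AllPairs using (allPairs?; []; _∷_)
import Data.Vec.Relation.Unary.AllPairs.Properties as VAllPairsₚ
import Data.Vec.Relation.Unary.Any as VAny
open import Data.Vec.Relation.Unary.Unique.Propositional using (Unique)
import Data.Vec.Relation.Unary.Unique.Propositional.Properties as Uniqueₚ
open import Function using (_∘_; id)
open import Relation.Binary.PropositionalEquality using (_≢_; refl; sym; trans; cong; cong₂; subst; module ≡-Reasoning)
open import Relation.Nullary using (¬_; Dec; yes; no; does; contradiction; ¬?)
open import Relation.Nullary.Decidable using (True; toWitness; map′; _×-dec_; dec⇒maybe)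

open TightCycle

-- Removing a 1-factor is what makes the counts work. On 3n vertices it leaves C(3n,3) - n = 9
-- n²(n-1)/2 triples, a multiple of 9 for every n, so W, X and T all have edge counts divisible by 9
-- as long as every part is a multiple of 3. The real obstacle is room: a tight 9-cycle needs nine
-- vertices. For v = 12 each half has 6 vertices and 18 remaining triples, and for v = 6 the 18
-- crossing triples lie on 6 vertices; neither admits a 9-cycle. Hence `18 ≤ v`, and hence W is
-- never cut into pieces below 9: removing 9 vertices at a time ends at 9, 12 or 15. Likewise X is
-- not reduced to 3+3, which has only six vertices. Each side is cut into sixes with a last piece of
-- 6 or 9. Only T goes down to parts of size 3, where its 27 triples live on exactly nine vertices.

private
  variable
    n k l : ℕ

-- Finite subsets

Disjoint : Subset n → Subset n → Set
Disjoint p q = ∀ {x} → x ∈ p → x ∈ q → Empty.⊥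

Disjoint-sym : {p q : Subset n} → Disjoint p q → Disjoint q p
Disjoint-sym d x∈q x∈p = d x∈p x∈q

Disjoint⇒Empty : {p q : Subset n} → Disjoint p q → Empty (p ∩ q)
Disjoint⇒Empty {p = p} {q} d (x , x∈) with x∈p , x∈q ← x∈p∩q⁻ p q x∈ = d x∈p x∈q

∣∪∣-disjoint : (p q : Subset n) → Disjoint p q → ∣ p ∪ q ∣ ≡ ∣ p ∣ + ∣ q ∣
∣∪∣-disjoint []            []            d = refl
∣∪∣-disjoint (outside ∷ p) (outside ∷ q) d = ∣∪∣-disjoint p q λ a b → d (there a) (there b)
∣∪∣-disjoint (inside  ∷ p) (outside ∷ q) d = cong suc (∣∪∣-disjoint p q λ a b → d (there a) (there b))
∣∪∣-disjoint (inside  ∷ p) (inside  ∷ q) d = ⊥-elim (d here here)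
∣∪∣-disjoint (outside ∷ p) (inside  ∷ q) d =
  trans (cong suc (∣∪∣-disjoint p q λ a b → d (there a) (there b))) (sym (ℕ.+-suc ∣ p ∣ ∣ q ∣))

⊆∧∣≡∣⇒≡ : {p q : Subset n} → p ⊆ q → ∣ p ∣ ≡ ∣ q ∣ → p ≡ q
⊆∧∣≡∣⇒≡ {p = []}          {[]}          p⊆q eq = refl
⊆∧∣≡∣⇒≡ {p = outside ∷ p} {outside ∷ q} p⊆q eq = cong (outside ∷_) (⊆∧∣≡∣⇒≡ (drop-∷-⊆ p⊆q) eq)
⊆∧∣≡∣⇒≡ {p = inside  ∷ p} {inside  ∷ q} p⊆q eq =
  cong (inside ∷_) (⊆∧∣≡∣⇒≡ (drop-∷-⊆ p⊆q) (ℕ.suc-injective eq))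
⊆∧∣≡∣⇒≡ {p = inside  ∷ p} {outside ∷ q} p⊆q eq with () ← p⊆q here
⊆∧∣≡∣⇒≡ {p = outside ∷ p} {inside  ∷ q} p⊆q eq =
  ⊥-elim (ℕ.<-irrefl eq (s≤s (p⊆q⇒∣p∣≤∣q∣ (drop-∷-⊆ p⊆q))))

split : ∀ k {l} (p : Subset n) → ∣ p ∣ ≡ k + l →
        ∃₂ λ q r → p ≡ q ∪ r × Disjoint q r × ∣ q ∣ ≡ k × ∣ r ∣ ≡ l
split {n = n} zero p eq = ⊥ , p , sym (∪-identityˡ p) , (λ x∈⊥ _ → ∉⊥ x∈⊥) , ∣⊥∣≡0 n , eq
split (suc k) (outside ∷ p) eq with q , r , p≡ , d , ∣q∣ , ∣r∣ ← split (suc k) p eq =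
  outside ∷ q , outside ∷ r , cong (outside ∷_) p≡ , (λ { (there a) (there b) → d a b }) , ∣q∣ , ∣r∣
split (suc k) (inside ∷ p) eq with q , r , p≡ , d , ∣q∣ , ∣r∣ ← split k p (ℕ.suc-injective eq) =
  inside ∷ q , outside ∷ r , cong (inside ∷_) p≡ , (λ { (there a) (there b) → d a b }) , cong suc ∣q∣ , ∣r∣

-- Enumerations of subsets

record Enumeration (p : Subset n) (k : ℕ) : Set where
  field
    list     : Vec (Fin n) k
    unique   : Unique list
    sound    : VAll.All (_∈ p) list
    complete : ∀ {x} → x ∈ p → x ∈ᵥ list

open Enumeration

enumerate : (p : Subset n) → Enumeration p ∣ p ∣
enumerate [] = record { list = [] ; unique = [] ; sound = [] ; complete = λ () }
enumerate (outside ∷ p) = record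
  { list     = Vec.map suc (list E)
  ; unique   = Uniqueₚ.map⁺ Fin.suc-injective (unique E)
  ; sound    = VAllₚ.map⁺ (VAll.map there (sound E))
  ; complete = λ { (there x∈p) → ∈ᵥ-map⁺ suc (complete E x∈p) }
  } where E = enumerate p
enumerate (inside ∷ p) = record
  { list     = zero ∷ Vec.map suc (list E)
  ; unique   = VAllₚ.map⁺ (VAll.universal (λ _ ()) (list E)) ∷ Uniqueₚ.map⁺ Fin.suc-injective (unique E)
  ; sound    = here ∷ VAllₚ.map⁺ (VAll.map there (sound E))
  ; complete = λ { here → VAny.here refl ; (there x∈p) → VAny.there (∈ᵥ-map⁺ suc (complete E x∈p)) }
  } where E = enumerate p

∅ₑ : Enumeration (⊥ {n}) 0
∅ₑ = record { list = [] ; unique = [] ; sound = [] ; complete = λ x∈⊥ → ⊥-elim (∉⊥ x∈⊥) }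

_⊕ₑ_by_ : {p q : Subset n} → Enumeration p k → Enumeration q l → Disjoint p q → Enumeration (p ∪ q) (k + l)
_⊕ₑ_by_ {p = p} {q} E F d = record
  { list     = list E Vec.++ list F
  ; unique   = VAllPairsₚ.++⁺ (unique E) (unique F)
                 (VAll.map (λ x∈p → VAll.map (λ y∈q x≡y → d x∈p (subst (_∈ q) (sym x≡y) y∈q)) (sound F)) (sound E))
  ; sound    = VAllₚ.++⁺ (VAll.map (λ x∈p → x∈p∪q⁺ (inj₁ x∈p)) (sound E))
                         (VAll.map (λ x∈q → x∈p∪q⁺ (inj₂ x∈q)) (sound F))
  ; complete = λ x∈ → [ ∈ᵥ-++⁺ˡ ∘ complete E , ∈ᵥ-++⁺ʳ (list E) ∘ complete F ]′ (x∈p∪q⁻ p q x∈)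
  }

-- Triples

triple : (x y z : Fin n) → Subset n
triple x y z = ⁅ x ⁆ ∪ ⁅ y ⁆ ∪ ⁅ z ⁆

∈-triple⁻ : ∀ {w} (x y z : Fin n) → w ∈ triple x y z → w ≡ x ⊎ w ≡ y ⊎ w ≡ z
∈-triple⁻ x y z w∈ with x∈p∪q⁻ ⁅ x ⁆ _ w∈
... | inj₁ w∈x = inj₁ (x∈⁅y⁆⇒x≡y x w∈x)
... | inj₂ w∈yz with x∈p∪q⁻ ⁅ y ⁆ _ w∈yz
...   | inj₁ w∈y = inj₂ (inj₁ (x∈⁅y⁆⇒x≡y y w∈y))
...   | inj₂ w∈z = inj₂ (inj₂ (x∈⁅y⁆⇒x≡y z w∈z))

∈-triple⁺ : ∀ {w} (x y z : Fin n) → w ≡ x ⊎ w ≡ y ⊎ w ≡ z → w ∈ triple x y z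
∈-triple⁺ x y z (inj₁ refl)        = x∈p∪q⁺ (inj₁ (x∈⁅x⁆ x))
∈-triple⁺ x y z (inj₂ (inj₁ refl)) = x∈p∪q⁺ (inj₂ (x∈p∪q⁺ (inj₁ (x∈⁅x⁆ y))))
∈-triple⁺ x y z (inj₂ (inj₂ refl)) = x∈p∪q⁺ (inj₂ (x∈p∪q⁺ {p = ⁅ y ⁆} (inj₂ (x∈⁅x⁆ z))))

triple⊆ : ∀ {x y z} {p : Subset n} → x ∈ p → y ∈ p → z ∈ p → triple x y z ⊆ p
triple⊆ {x = x} {y} {z} x∈p y∈p z∈p w∈ with ∈-triple⁻ x y z w∈
... | inj₁ refl        = x∈p
... | inj₂ (inj₁ refl) = y∈p
... | inj₂ (inj₂ refl) = z∈p

∣⁅x⁆∪p∣ : ∀ {x} {p : Subset n} → ¬ (x ∈ p) → ∣ ⁅ x ⁆ ∪ p ∣ ≡ suc ∣ p ∣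
∣⁅x⁆∪p∣ {x = x} {p} x∉p = trans
  (∣∪∣-disjoint ⁅ x ⁆ p λ y∈ y∈p → x∉p (subst (_∈ p) (x∈⁅y⁆⇒x≡y x y∈) y∈p))
  (cong (_+ ∣ p ∣) (∣⁅x⁆∣≡1 x))

∣triple∣ : ∀ {x y z : Fin n} → x ≢ y → x ≢ z → y ≢ z → ∣ triple x y z ∣ ≡ 3
∣triple∣ {x = x} {y} {z} x≢y x≢z y≢z = trans
  (∣⁅x⁆∪p∣ λ x∈ → [ (λ x∈y → x≢y (x∈⁅y⁆⇒x≡y y x∈y)) , (λ x∈z → x≢z (x∈⁅y⁆⇒x≡y z x∈z)) ]′ (x∈p∪q⁻ ⁅ y ⁆ _ x∈))
  (cong suc (trans (∣⁅x⁆∪p∣ λ y∈z → y≢z (x∈⁅y⁆⇒x≡y z y∈z)) (cong suc (∣⁅x⁆∣≡1 z))))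

-- Transporting `enumerate e` along the size equation turns its list into a vector of length 3, so
-- that pattern matching names the three vertices.
∣e∣≡3⇒triple : (e : Subset n) → ∣ e ∣ ≡ 3 →
               ∃ λ x → ∃₂ λ y z → e ≡ triple x y z × x ≢ y × x ≢ z × y ≢ z
∣e∣≡3⇒triple e ∣e∣≡3 with record { list = x ∷ y ∷ z ∷ [] ; unique = (x≢y ∷ x≢z ∷ []) ∷ (y≢z ∷ []) ∷ _
                                 ; sound = x∈e ∷ y∈e ∷ z∈e ∷ [] ; complete = complete }
                            ← subst (Enumeration e) ∣e∣≡3 (enumerate e) =
  x , y , z , ⊆-antisym (λ w∈e → ∈-triple⁺ x y z (position (complete w∈e))) (triple⊆ x∈e y∈e z∈e)
  , x≢y , x≢z , y≢z
  where
  position : ∀ {w} → w ∈ᵥ x ∷ y ∷ z ∷ [] → w ≡ x ⊎ w ≡ y ⊎ w ≡ z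
  position (VAny.here w≡x)                           = inj₁ w≡x
  position (VAny.there (VAny.here w≡y))              = inj₂ (inj₁ w≡y)
  position (VAny.there (VAny.there (VAny.here w≡z))) = inj₂ (inj₂ w≡z)

∣e∣≡3⇒Nonempty : {e : Subset n} → ∣ e ∣ ≡ 3 → Nonempty e
∣e∣≡3⇒Nonempty {e = e} ∣e∣≡3 with x , y , z , refl , _ ← ∣e∣≡3⇒triple e ∣e∣≡3 = x , ∈-triple⁺ x y z (inj₁ refl)

∣e∣≡3⇒¬4 : ∀ {e : Subset n} {w x y z} → ∣ e ∣ ≡ 3 → w ∈ e → x ∈ e → y ∈ e → z ∈ e →
           w ≢ x → w ≢ y → w ≢ z → x ≢ y → x ≢ z → y ≢ z → Empty.⊥
∣e∣≡3⇒¬4 {e = e} {w} {x} {y} {z} ∣e∣≡3 w∈e x∈e y∈e z∈e w≢x w≢y w≢z x≢y x≢z y≢z =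
  ℕ.1+n≰n (subst (4 ≤_) ∣e∣≡3 (subst (_≤ ∣ e ∣) size (p⊆q⇒∣p∣≤∣q∣ sub)))
  where
  size : ∣ ⁅ w ⁆ ∪ triple x y z ∣ ≡ 4
  size = trans (∣⁅x⁆∪p∣ λ w∈ → [ w≢x , [ w≢y , w≢z ]′ ]′ (∈-triple⁻ x y z w∈))
               (cong suc (∣triple∣ x≢y x≢z y≢z))
  sub : ⁅ w ⁆ ∪ triple x y z ⊆ e
  sub v∈ with x∈p∪q⁻ ⁅ w ⁆ _ v∈
  ... | inj₁ v∈w = subst (_∈ e) (sym (x∈⁅y⁆⇒x≡y w v∈w)) w∈e
  ... | inj₂ v∈t = triple⊆ x∈e y∈e z∈e v∈t

-- A finite check over the nine positions, wrap-around included. Together with distinctness of the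
-- vertices it makes every edge of a 9-cycle a genuine 3-set.
consecutive-distinct : (i : Fin 9) → (toℕ i + 0) mod 9 ≢ (toℕ i + 1) mod 9
                                   × (toℕ i + 0) mod 9 ≢ (toℕ i + 2) mod 9
                                   × (toℕ i + 1) mod 9 ≢ (toℕ i + 2) mod 9
consecutive-distinct =
  toWitness {a? = Fin.all? λ i →       ¬? ((toℕ i + 0) mod 9 Fin.≟ (toℕ i + 1) mod 9)
                           ×-dec ¬? ((toℕ i + 0) mod 9 Fin.≟ (toℕ i + 2) mod 9)
                           ×-dec ¬? ((toℕ i + 1) mod 9 Fin.≟ (toℕ i + 2) mod 9)} tt

cycleEdge-size : (C : TightCycle 9 n) (i : Fin 9) → ∣ cycleEdge C i ∣ ≡ 3
cycleEdge-size C i with p , q , r ← consecutive-distinct i =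
  ∣triple∣ (p ∘ lookup-injective) (q ∘ lookup-injective) (r ∘ lookup-injective)
  where
  lookup-injective : ∀ {a b} → lookup (vertices C) a ≡ lookup (vertices C) b → a ≡ b
  lookup-injective = Uniqueₚ.lookup-injective (distinct C) _ _

-- Decompositions

Decomposable : Hypergraph n → Set
Decomposable {n} H = Σ[ Cs ∈ List (TightCycle 9 n) ] IsDecomposition H Cs

IsDecomposition-cong : {H H′ : Hypergraph n} {Cs : List (TightCycle 9 n)} → IsDecomposition H Cs →
  (∀ e → H e → H′ e) → (∀ e → H′ e → H e) → IsDecomposition H′ Cs
IsDecomposition-cong D H⇒H′ H′⇒H = record
  { within   = All.map (λ w e e∈C → H⇒H′ e (w e e∈C)) within
  ; disjoint = disjoint
  ; covers   = λ e h → covers e (H′⇒H e h)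
  } where open IsDecomposition D

IsDecomposition-++ : {H H₁ H₂ : Hypergraph n} {Cs₁ Cs₂ : List (TightCycle 9 n)} →
  IsDecomposition H₁ Cs₁ → IsDecomposition H₂ Cs₂ →
  (∀ e → H e → H₁ e ⊎ H₂ e) → (∀ e → H₁ e → H e) → (∀ e → H₂ e → H e) →
  (∀ e → H₁ e → H₂ e → Empty.⊥) → IsDecomposition H (Cs₁ ++ Cs₂)
IsDecomposition-++ {Cs₁ = Cs₁} D₁ D₂ cover sub₁ sub₂ disj = record
  { within   = Allₚ.++⁺ (All.map (λ w e e∈C → sub₁ e (w e e∈C)) D₁.within)
                        (All.map (λ w e e∈C → sub₂ e (w e e∈C)) D₂.within)
  ; disjoint = AllPairsₚ.++⁺ D₁.disjoint D₂.disjoint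
                 (All.map (λ w₁ → All.map (λ w₂ e (e∈C , e∈D) → disj e (w₁ e e∈C) (w₂ e e∈D)) D₂.within) D₁.within)
  ; covers   = λ e h → [ Anyₚ.++⁺ˡ ∘ D₁.covers e , Anyₚ.++⁺ʳ Cs₁ ∘ D₂.covers e ]′ (cover e h)
  }
  where
  module D₁ = IsDecomposition D₁
  module D₂ = IsDecomposition D₂

-- Covers all the hypergraphs needed: for a partition Ps into 3-sets and a 3-set e, e ∉ Ps holds iff e meets ∁ P
-- for every P in Ps.
Transversal : Subset n → List (Subset n) → Hypergraph n
Transversal U Ss e = ∣ e ∣ ≡ 3 × e ⊆ U × All (λ S → Nonempty (e ∩ S)) Ss

-- Relabelling the vertices along an enumeration

module _ (xs : Vec (Fin n) k) where

  -- The preimage of `S` under `lookup xs`, as a characteristic vector.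
  pull : Subset n → Subset k
  pull S = Vec.map (lookup S) xs

  ∈-pull⁺ : ∀ {i} S → lookup xs i ∈ S → i ∈ pull S
  ∈-pull⁺ {i} S x∈S = Vecₚ.lookup⇒[]= i _ (trans (Vecₚ.lookup-map i (lookup S) xs) (Vecₚ.[]=⇒lookup x∈S))

  ∈-pull⁻ : ∀ {i} S → i ∈ pull S → lookup xs i ∈ S
  ∈-pull⁻ {i} S i∈ = Vecₚ.lookup⇒[]= _ S (trans (sym (Vecₚ.lookup-map i (lookup S) xs)) (Vecₚ.[]=⇒lookup i∈))

  pull-∁ : ∀ S → pull (∁ S) ≡ ∁ (pull S)
  pull-∁ S = trans (Vecₚ.map-cong (λ x → Vecₚ.lookup-map x not S) xs) (Vecₚ.map-∘ not (lookup S) xs)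

∈ᵥ⇒lookup : ∀ {x} {xs : Vec (Fin n) k} → x ∈ᵥ xs → ∃ λ i → x ≡ lookup xs i
∈ᵥ⇒lookup (VAny.here refl) = zero , refl
∈ᵥ⇒lookup (VAny.there x∈) with i , refl ← ∈ᵥ⇒lookup x∈ = suc i , refl

module Relabelling {U : Subset n} (E : Enumeration U k) where

  private
    xs = list E

    injective : ∀ {i j} → lookup xs i ≡ lookup xs j → i ≡ j
    injective = Uniqueₚ.lookup-injective (unique E) _ _

    index : ∀ {x} → x ∈ U → ∃ λ i → x ≡ lookup xs i
    index x∈U = ∈ᵥ⇒lookup (complete E x∈U)

  pull-injective : ∀ {p q} → p ⊆ U → q ⊆ U → pull xs p ≡ pull xs q → p ≡ q
  pull-injective p⊆U q⊆U eq = ⊆-antisym (transfer p⊆U eq) (transfer q⊆U (sym eq))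
    where
    transfer : ∀ {p q} → p ⊆ U → pull xs p ≡ pull xs q → p ⊆ q
    transfer {p} {q} p⊆U eq x∈p with i , refl ← index (p⊆U x∈p) =
      ∈-pull⁻ xs q (subst (i ∈_) eq (∈-pull⁺ xs p x∈p))

  pull-triple : ∀ a b c → pull xs (triple (lookup xs a) (lookup xs b) (lookup xs c)) ≡ triple a b c
  pull-triple a b c = ⊆-antisym
    (λ i∈ → ∈-triple⁺ a b c (lower (∈-triple⁻ _ _ _ (∈-pull⁻ xs t i∈))))
    (triple⊆ (∈-pull⁺ xs t (∈-triple⁺ _ _ _ (inj₁ refl)))
             (∈-pull⁺ xs t (∈-triple⁺ _ _ _ (inj₂ (inj₁ refl))))
             (∈-pull⁺ xs t (∈-triple⁺ _ _ _ (inj₂ (inj₂ refl)))))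
    where
    t = triple (lookup xs a) (lookup xs b) (lookup xs c)
    lower : ∀ {i} → lookup xs i ≡ lookup xs a ⊎ lookup xs i ≡ lookup xs b ⊎ lookup xs i ≡ lookup xs c →
            i ≡ a ⊎ i ≡ b ⊎ i ≡ c
    lower (inj₁ eq)        = inj₁ (injective eq)
    lower (inj₂ (inj₁ eq)) = inj₂ (inj₁ (injective eq))
    lower (inj₂ (inj₂ eq)) = inj₂ (inj₂ (injective eq))

  relabel : TightCycle 9 k → TightCycle 9 n
  relabel C = record
    { vertices = Vec.map (lookup xs) (vertices C)
    ; distinct = Uniqueₚ.map⁺ injective (distinct C)
    }

  cycleEdge-relabel : ∀ C i → cycleEdge (relabel C) i ≡ triple (lookup xs (lookup (vertices C) ((toℕ i + 0) mod 9)))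
                                                               (lookup xs (lookup (vertices C) ((toℕ i + 1) mod 9)))
                                                               (lookup xs (lookup (vertices C) ((toℕ i + 2) mod 9)))
  cycleEdge-relabel C i = cong₂ _∪_ (image 0) (cong₂ _∪_ (image 1) (image 2))
    where
    image : ∀ j → ⁅ lookup (Vec.map (lookup xs) (vertices C)) ((toℕ i + j) mod 9) ⁆ ≡
                  ⁅ lookup xs (lookup (vertices C) ((toℕ i + j) mod 9)) ⁆
    image j = cong ⁅_⁆ (Vecₚ.lookup-map ((toℕ i + j) mod 9) (lookup xs) (vertices C))

  cycleEdge-relabel⊆ : ∀ C i → cycleEdge (relabel C) i ⊆ U
  cycleEdge-relabel⊆ C i rewrite cycleEdge-relabel C i = triple⊆ (at∈U _) (at∈U _) (at∈U _)
    where
    at∈U : ∀ j → lookup xs j ∈ U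
    at∈U = VAllₚ.lookup⁺ (sound E)

  pull-cycleEdge : ∀ C i → pull xs (cycleEdge (relabel C) i) ≡ cycleEdge C i
  pull-cycleEdge C i = trans (cong (pull xs) (cycleEdge-relabel C i)) (pull-triple _ _ _)

  edges-relabel⁻ : ∀ C {e} → edges (relabel C) e → edges C (pull xs e)
  edges-relabel⁻ C (i , e≡) = i , trans (cong (pull xs) e≡) (pull-cycleEdge C i)

  ∣pull∣ : ∀ {e} → ∣ e ∣ ≡ 3 → e ⊆ U → ∣ pull xs e ∣ ≡ 3
  ∣pull∣ {e} ∣e∣≡3 e⊆U with x , y , z , refl , x≢y , x≢z , y≢z ← ∣e∣≡3⇒triple e ∣e∣≡3
    with a , refl ← index (e⊆U (∈-triple⁺ x y z (inj₁ refl)))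
       | b , refl ← index (e⊆U (∈-triple⁺ x y z (inj₂ (inj₁ refl))))
       | c , refl ← index (e⊆U (∈-triple⁺ x y z (inj₂ (inj₂ refl)))) =
    trans (cong ∣_∣ (pull-triple a b c))
          (∣triple∣ (x≢y ∘ cong (lookup xs)) (x≢z ∘ cong (lookup xs)) (y≢z ∘ cong (lookup xs)))

  pull-meets⁺ : ∀ {e} S → e ⊆ U → Nonempty (e ∩ S) → Nonempty (pull xs e ∩ pull xs S)
  pull-meets⁺ {e} S e⊆U (x , x∈) with x∈e , x∈S ← x∈p∩q⁻ e S x∈ with i , refl ← index (e⊆U x∈e) =
    i , x∈p∩q⁺ (∈-pull⁺ xs e x∈e , ∈-pull⁺ xs S x∈S)

  pull-meets⁻ : ∀ {e} S → Nonempty (pull xs e ∩ pull xs S) → Nonempty (e ∩ S)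
  pull-meets⁻ {e} S (i , i∈) with i∈e , i∈S ← x∈p∩q⁻ (pull xs e) _ i∈ =
    lookup xs i , x∈p∩q⁺ (∈-pull⁻ xs e i∈e , ∈-pull⁻ xs S i∈S)

  -- Cycles are pushed forward along `xs` while sets are pulled back. Since `pull` is injective on
  -- subsets of `U`, a set `e ⊆ U` is an edge of `relabel C` exactly when `pull xs e` is an edge of
  -- `C`; size 3 and meeting a set survive the passage as well.
  relabel-decomposition : ∀ {Ss Cs} → IsDecomposition (Transversal ⊤ (List.map (pull xs) Ss)) Cs →
                          IsDecomposition (Transversal U Ss) (List.map relabel Cs)
  relabel-decomposition {Ss} {Cs} D = record
    { within   = Allₚ.map⁺ (All.map (λ {C} → within′ C) D.within)
    ; disjoint = AllPairsₚ.map⁺ (AllPairs.map (λ {C} {C′} → disjoint′ C C′) D.disjoint)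
    ; covers   = covers′
    }
    where
    module D = IsDecomposition D
    within′ : ∀ C → (∀ e → edges C e → Transversal ⊤ (List.map (pull xs) Ss) e) →
              ∀ e → edges (relabel C) e → Transversal U Ss e
    within′ C w e e∈C@(i , refl) with _ , _ , meets ← w (pull xs e) (edges-relabel⁻ C e∈C) =
      cycleEdge-size (relabel C) i , cycleEdge-relabel⊆ C i
      , All.map (λ {S} → pull-meets⁻ S) (Allₚ.map⁻ meets)
    disjoint′ : ∀ C C′ → (∀ e → ¬ (edges C e × edges C′ e)) → ∀ e → ¬ (edges (relabel C) e × edges (relabel C′) e)
    disjoint′ C C′ d e (e∈C , e∈C′) = d (pull xs e) (edges-relabel⁻ C e∈C , edges-relabel⁻ C′ e∈C′)
    covers′ : ∀ e → Transversal U Ss e → Any (λ C → edges C e) (List.map relabel Cs)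
    covers′ e (∣e∣≡3 , e⊆U , meets) = Anyₚ.map⁺ (Any.map (λ {C} → lift C)
      (D.covers (pull xs e) (∣pull∣ ∣e∣≡3 e⊆U , ⊆⊤ , Allₚ.map⁺ (All.map (λ {S} → pull-meets⁺ S e⊆U) meets))))
      where
      lift : ∀ C → edges C (pull xs e) → edges (relabel C) e
      lift C (i , eq) = i , pull-injective e⊆U (cycleEdge-relabel⊆ C i) (trans eq (sym (pull-cycleEdge C i)))

-- Partitions into blocks of prescribed sizes

intervals : (ns : List ℕ) → List (Subset (sum ns))
intervals []       = []
intervals (k ∷ ns) = (⊤ {k} Vec.++ ⊥) ∷ List.map (⊥ {k} Vec.++_) (intervals ns)

pull≡⊤ : ∀ {S : Subset n} {xs : Vec (Fin n) k} → VAll.All (_∈ S) xs → pull xs S ≡ ⊤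
pull≡⊤ []           = refl
pull≡⊤ (x∈S ∷ xs∈S) = cong₂ _∷_ (Vecₚ.[]=⇒lookup x∈S) (pull≡⊤ xs∈S)

pull≡⊥ : ∀ {S : Subset n} {xs : Vec (Fin n) k} → VAll.All (λ x → ¬ x ∈ S) xs → pull xs S ≡ ⊥
pull≡⊥ {S = S} {xs} xs∉S = Empty-unique λ (i , i∈) → VAllₚ.lookup⁺ xs∉S i (∈-pull⁻ xs S i∈)

∈⋃⁻ : ∀ {x} (Ps : List (Subset n)) → x ∈ ⋃ Ps → Any (x ∈_) Ps
∈⋃⁻ []       x∈ = ⊥-elim (∉⊥ x∈)
∈⋃⁻ (P ∷ Ps) x∈ = [ here , there ∘ ∈⋃⁻ Ps ]′ (x∈p∪q⁻ P (⋃ Ps) x∈)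

∈⋃⁺ : ∀ {x} {Ps : List (Subset n)} → Any (x ∈_) Ps → x ∈ ⋃ Ps
∈⋃⁺ (here x∈P)  = x∈p∪q⁺ (inj₁ x∈P)
∈⋃⁺ (there x∈Q) = x∈p∪q⁺ (inj₂ (∈⋃⁺ x∈Q))

Disjoint-⋃ : ∀ {P : Subset n} {Ps} → All (Disjoint P) Ps → Disjoint P (⋃ Ps)
Disjoint-⋃ {Ps = Ps} ds x∈P x∈⋃ with d , x∈Q ← All.lookupAny ds (∈⋃⁻ Ps x∈⋃) = d x∈P x∈Q

-- Block after block, unlike `enumerate (⋃ Ps)`, which would list the vertices in increasing order
-- and interleave the blocks. The position in the list then determines the block.
enumerate-⋃ : (Ps : List (Subset n)) → AllPairs Disjoint Ps → Enumeration (⋃ Ps) (sum (List.map ∣_∣ Ps))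
enumerate-⋃ []       []       = ∅ₑ
enumerate-⋃ (P ∷ Ps) (d ∷ ds) = enumerate P ⊕ₑ enumerate-⋃ Ps ds by Disjoint-⋃ d

-- The first stretch of the list lies in `P` and the remainder outside it, so `P` pulls back to `⊤`
-- followed by `⊥`. Every later block misses the first stretch and is governed by the induction
-- hypothesis on the remainder.
pull-blocks : (Ps : List (Subset n)) (ds : AllPairs Disjoint Ps) →
              List.map (pull (list (enumerate-⋃ Ps ds))) Ps ≡ intervals (List.map ∣_∣ Ps)
pull-blocks []       []       = refl
pull-blocks (P ∷ Ps) (d ∷ ds) = cong₂ _∷_
  (trans (pull-++ P) (cong₂ Vec._++_ (pull≡⊤ (sound E)) (pull≡⊥ (VAll.map (λ x∈⋃ x∈P → Disjoint-⋃ d x∈P x∈⋃) (sound F)))))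
  (trans (All⇒map-≡ (All.map (λ {Q} PQ → trans (pull-++ Q) (cong (Vec._++ _) (pull≡⊥ (VAll.map (λ x∈P → PQ x∈P) (sound E))))) d))
  (trans (map-∘ Ps) (cong (List.map (⊥ Vec.++_)) (pull-blocks Ps ds))))
  where
  E = enumerate P
  F = enumerate-⋃ Ps ds
  pull-++ : ∀ S → pull (list E Vec.++ list F) S ≡ pull (list E) S Vec.++ pull (list F) S
  pull-++ S = Vecₚ.map-++ (lookup S) (list E) (list F)
  All⇒map-≡ : ∀ {A B : Set} {f g : A → B} {as} → All (λ a → f a ≡ g a) as → List.map f as ≡ List.map g as
  All⇒map-≡ []       = refl
  All⇒map-≡ (p ∷ ps) = cong₂ _∷_ p (All⇒map-≡ ps)

module _ {ns : List ℕ} {Ps : List (Subset n)} where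

  meeting-blocks : List.map ∣_∣ Ps ≡ ns → AllPairs Disjoint Ps →
                   Decomposable (Transversal ⊤ (intervals ns)) → Decomposable (Transversal (⋃ Ps) Ps)
  meeting-blocks refl ds (Cs , D) =
    _ , Relabelling.relabel-decomposition (enumerate-⋃ Ps ds)
          (subst (λ Ss → IsDecomposition (Transversal ⊤ Ss) Cs) (sym (pull-blocks Ps ds)) D)

  -- Complements are taken in all of `Fin n`, not in `⋃ Ps`. As `pull` commutes with `∁`, they still
  -- become the complements of the intervals.
  avoiding-blocks : List.map ∣_∣ Ps ≡ ns → AllPairs Disjoint Ps →
                    Decomposable (Transversal ⊤ (List.map ∁ (intervals ns))) →
                    Decomposable (Transversal (⋃ Ps) (List.map ∁ Ps))
  avoiding-blocks refl ds (Cs , D) =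
    _ , Relabelling.relabel-decomposition E
          (subst (λ Ss → IsDecomposition (Transversal ⊤ Ss) Cs) (sym pulled) D)
    where
    E = enumerate-⋃ Ps ds
    open ≡-Reasoning
    pulled : List.map (pull (list E)) (List.map ∁ Ps) ≡ List.map ∁ (intervals (List.map ∣_∣ Ps))
    pulled = begin
      List.map (pull (list E)) (List.map ∁ Ps)  ≡⟨ map-∘ Ps ⟨
      List.map (pull (list E) ∘ ∁) Ps           ≡⟨ map-cong (pull-∁ (list E)) Ps ⟩
      List.map (∁ ∘ pull (list E)) Ps           ≡⟨ map-∘ Ps ⟩
      List.map ∁ (List.map (pull (list E)) Ps)  ≡⟨ cong (List.map ∁) (pull-blocks Ps ds) ⟩
      List.map ∁ (intervals (List.map ∣_∣ Ps))  ∎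

-- Verification of explicit decompositions

restrict : Side → List (Subset (suc n)) → List (Subset n)
restrict b       []                  = []
restrict inside  ((inside  ∷ p) ∷ L) = p ∷ restrict inside L
restrict inside  ((outside ∷ p) ∷ L) = restrict inside L
restrict outside ((inside  ∷ p) ∷ L) = restrict outside L
restrict outside ((outside ∷ p) ∷ L) = p ∷ restrict outside L

-- Defined coordinatewise so that the counts of all 3-sets together are obtained by radix sorting L.
count : Subset n → List (Subset n) → ℕ
count []      L = length L
count (b ∷ e) L = count e (restrict b L)

restrict-++ : ∀ b (L M : List (Subset (suc n))) → restrict b (L ++ M) ≡ restrict b L ++ restrict b M
restrict-++ b       []                  M = refl
restrict-++ inside  ((inside  ∷ p) ∷ L) M = cong (p ∷_) (restrict-++ inside L M)
restrict-++ inside  ((outside ∷ p) ∷ L) M = restrict-++ inside L M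
restrict-++ outside ((inside  ∷ p) ∷ L) M = restrict-++ outside L M
restrict-++ outside ((outside ∷ p) ∷ L) M = cong (p ∷_) (restrict-++ outside L M)

count-++ : ∀ (e : Subset n) L M → count e (L ++ M) ≡ count e L + count e M
count-++ []      L M = length-++ L
count-++ (b ∷ e) L M = trans (cong (count e) (restrict-++ b L M)) (count-++ e (restrict b L) (restrict b M))

∈-restrict⁺ : ∀ b {e : Subset n} {L} → (b ∷ e) ∈ₗ L → e ∈ₗ restrict b L
∈-restrict⁺ inside                            (here refl) = here refl
∈-restrict⁺ outside                           (here refl) = here refl
∈-restrict⁺ inside  {L = (inside  ∷ p) ∷ L} (there e∈)  = there (∈-restrict⁺ inside e∈)
∈-restrict⁺ inside  {L = (outside ∷ p) ∷ L} (there e∈)  = ∈-restrict⁺ inside e∈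
∈-restrict⁺ outside {L = (inside  ∷ p) ∷ L} (there e∈)  = ∈-restrict⁺ outside e∈
∈-restrict⁺ outside {L = (outside ∷ p) ∷ L} (there e∈)  = there (∈-restrict⁺ outside e∈)

∈-restrict⁻ : ∀ b {e : Subset n} L → e ∈ₗ restrict b L → (b ∷ e) ∈ₗ L
∈-restrict⁻ inside  ((inside  ∷ p) ∷ L) (here refl) = here refl
∈-restrict⁻ inside  ((inside  ∷ p) ∷ L) (there e∈)  = there (∈-restrict⁻ inside L e∈)
∈-restrict⁻ inside  ((outside ∷ p) ∷ L) e∈          = there (∈-restrict⁻ inside L e∈)
∈-restrict⁻ outside ((inside  ∷ p) ∷ L) e∈          = there (∈-restrict⁻ outside L e∈)
∈-restrict⁻ outside ((outside ∷ p) ∷ L) (here refl) = here refl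
∈-restrict⁻ outside ((outside ∷ p) ∷ L) (there e∈)  = there (∈-restrict⁻ outside L e∈)

∈⇒count>0 : ∀ {e : Subset n} {L} → e ∈ₗ L → 1 ≤ count e L
∈⇒count>0 {e = []}    {_ ∷ _} _  = s≤s z≤n
∈⇒count>0 {e = b ∷ e}         e∈ = ∈⇒count>0 (∈-restrict⁺ b e∈)

count>0⇒∈ : ∀ (e : Subset n) L → 1 ≤ count e L → e ∈ₗ L
count>0⇒∈ []      ([] ∷ L) _ = here refl
count>0⇒∈ (b ∷ e) L        c = ∈-restrict⁻ b L (count>0⇒∈ e (restrict b L) c)

-- A single traversal of the binary tree of characteristic vectors: sets with a common prefix share
-- one restricted list, and a leaf merely compares a length.
counts? : ∀ n k (f : Subset n → ℕ) L → Dec (∀ e → ∣ e ∣ ≡ k → count e L ≡ f e)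
counts? zero    zero    f L = map′ (λ { eq [] _ → eq }) (λ h → h [] refl) (length L ℕ.≟ f [])
counts? zero    (suc k) f L = yes λ { [] () }
counts? (suc n) zero    f L = map′ (λ { h (outside ∷ e) eq → h e eq }) (λ h e → h (outside ∷ e))
  (counts? n zero (f ∘ (outside ∷_)) (restrict outside L))
counts? (suc n) (suc k) f L = map′
  (λ { (h , h′) (inside ∷ e) eq → h e (ℕ.suc-injective eq) ; (h , h′) (outside ∷ e) eq → h′ e eq })
  (λ h → (λ e eq → h (inside ∷ e) (cong suc eq)) , (λ e → h (outside ∷ e)))
  (counts? n k (f ∘ (inside ∷_)) (restrict inside L) ×-dec counts? n (suc k) (f ∘ (outside ∷_)) (restrict outside L))

meets? : (Ss : List (Subset n)) (e : Subset n) → Dec (All (λ S → Nonempty (e ∩ S)) Ss)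
meets? Ss e = All.all? (λ S → nonempty? (e ∩ S)) Ss

edgeList : TightCycle 9 n → List (Subset n)
edgeList C = List.tabulate (cycleEdge C)

edges⇒∈ : ∀ (C : TightCycle 9 n) {e} → edges C e → e ∈ₗ edgeList C
edges⇒∈ C (i , refl) = ∈-tabulate⁺ {f = cycleEdge C} i

edges⇒size : ∀ (C : TightCycle 9 n) {e} → edges C e → ∣ e ∣ ≡ 3
edges⇒size C (i , refl) = cycleEdge-size C i

module _ (Ss : List (Subset n)) (Cs : List (TightCycle 9 n)) where

  weight : Subset n → ℕ
  weight e = if does (meets? Ss e) then 1 else 0

  -- One equation of multiplicities carries all three requirements: value 0 off the hypergraph gives
  -- `within`, at most 1 gives `disjoint`, and 1 on the hypergraph gives `covers`.
  verified? : Dec (∀ e → ∣ e ∣ ≡ 3 → count e (concatMap edgeList Cs) ≡ weight e)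
  verified? = counts? n 3 weight (concatMap edgeList Cs)

  weight≤1 : ∀ e → weight e ≤ 1
  weight≤1 e with meets? Ss e
  ... | yes _ = s≤s z≤n
  ... | no  _ = z≤n

  weight>0⇒meets : ∀ e → 1 ≤ weight e → All (λ S → Nonempty (e ∩ S)) Ss
  weight>0⇒meets e w with meets? Ss e
  ... | yes m = m

  meets⇒weight>0 : ∀ e → All (λ S → Nonempty (e ∩ S)) Ss → 1 ≤ weight e
  meets⇒weight>0 e m with meets? Ss e
  ... | yes _ = s≤s z≤n
  ... | no ¬m = contradiction m ¬m

count≤1⇒disjoint : (Cs : List (TightCycle 9 n)) →
  (∀ e → ∣ e ∣ ≡ 3 → count e (concatMap edgeList Cs) ≤ 1) →
  AllPairs (λ C D → ∀ e → ¬ (edges C e × edges D e)) Cs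
count≤1⇒disjoint []       h = []
count≤1⇒disjoint (C ∷ Cs) h =
  All.tabulate (λ {D} D∈ e (e∈C , e∈D) → ℕ.1+n≰n (ℕ.≤-trans
    (ℕ.+-mono-≤ (∈⇒count>0 (edges⇒∈ C e∈C))
                (∈⇒count>0 (Anyₚ.concatMap⁺ edgeList (Any.map (λ { refl → edges⇒∈ D e∈D }) D∈))))
    (h′ e (edges⇒size C e∈C))))
  ∷ count≤1⇒disjoint Cs (λ e eq → ℕ.≤-trans (ℕ.m≤n+m _ _) (h′ e eq))
  where
  h′ : ∀ e → ∣ e ∣ ≡ 3 → count e (edgeList C) + count e (concatMap edgeList Cs) ≤ 1
  h′ e eq = subst (_≤ 1) (count-++ e (edgeList C) _) (h e eq)

verified : (Ss : List (Subset n)) (Cs : List (TightCycle 9 n)) {_ : True (verified? Ss Cs)} →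
           Decomposable (Transversal ⊤ Ss)
verified Ss Cs {ok} = Cs , record
  { within   = All.tabulate λ {C} C∈Cs e e∈C → edges⇒size C e∈C , ⊆⊤ ,
      weight>0⇒meets Ss Cs e (subst (1 ≤_) (counts e (edges⇒size C e∈C))
        (∈⇒count>0 (Anyₚ.concatMap⁺ edgeList (Any.map (λ { refl → edges⇒∈ C e∈C }) C∈Cs))))
  ; disjoint = count≤1⇒disjoint Cs λ e eq → subst (_≤ 1) (sym (counts e eq)) (weight≤1 Ss Cs e)
  ; covers   = λ e (eq , _ , m) → Any.map ∈-tabulate⁻ (Anyₚ.concatMap⁻ edgeList
      (count>0⇒∈ e _ (subst (1 ≤_) (sym (counts e eq)) (meets⇒weight>0 Ss Cs e m))))
  }
  where
  counts : ∀ e → ∣ e ∣ ≡ 3 → count e (concatMap edgeList Cs) ≡ weight Ss Cs e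
  counts = toWitness ok

-- Explicit decompositions, found by computer search among those with a prescribed automorphism σ

-- Vectors with a repeated entry are silently dropped; the verification would then fail to find their edges.
tightCycle : .{{_ : NonZero n}} → Vec ℕ 9 → Maybe (TightCycle 9 n)
tightCycle {n} xs = Maybe.map (λ u → record { vertices = ys ; distinct = u })
                              (dec⇒maybe (allPairs? (λ x y → ¬? (x Fin.≟ y)) ys))
  where
  ys : Vec (Fin n) 9
  ys = Vec.map (_mod n) xs

-- Here `k` is the order of `σ`. In every use below, a triple fixed by a nontrivial power of `σ`
-- lies outside the hypergraph (it is a triple of the 1-factor, or inside one part), so edge orbits
-- have full length and the base cycles need exactly one edge from each orbit.
develop : .{{_ : NonZero n}} → (ℕ → ℕ) → ℕ → List (Vec ℕ 9) → List (TightCycle 9 n)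
develop σ k Bs = mapMaybe tightCycle (concatMap (λ B → iterate (Vec.map σ) B k) Bs)

rotate : (k : ℕ) .{{_ : NonZero k}} → ℕ → ℕ
rotate k x = x / k * k + suc (x % k) % k

-- The permutation (0 1 2 3 4)(5)(6 7 8 9 10)(11), fixing one point in each block of 6. The 180
-- crossing triples need 20 cycles, which cannot form full orbits of length 3 but do form four of
-- length 5.
rotate₅₁ : ℕ → ℕ
rotate₅₁ 4  = 0
rotate₅₁ 5  = 5
rotate₅₁ 10 = 6
rotate₅₁ 11 = 11
rotate₅₁ x  = suc x

-- These follow a pattern. With a_i = i, b_j = 3 + j, c_k = 6 + k and indices mod 3, the cycle for s
-- = 0, 1, 2 runs through a_i, b_(i+s), c_(i+2s) for i = 0, 1, 2. Its edges a_i b_j c_k have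
-- difference pairs (j-i, k-i) equal to (s, 2s), (s-1, 2s-1) and (s, 2s-1), each for all i; over the
-- three values of s these are all nine pairs.
tripartite-cycles : List (TightCycle 9 9)
tripartite-cycles = develop id 1 (
  (0 ∷ 3 ∷ 6 ∷ 1 ∷ 4 ∷ 7 ∷ 2 ∷ 5 ∷ 8 ∷ []) ∷
  (0 ∷ 4 ∷ 8 ∷ 1 ∷ 5 ∷ 6 ∷ 2 ∷ 3 ∷ 7 ∷ []) ∷
  (0 ∷ 5 ∷ 7 ∷ 1 ∷ 3 ∷ 8 ∷ 2 ∷ 4 ∷ 6 ∷ []) ∷
  [])

crossing₆₆-cycles : List (TightCycle 9 12)
crossing₆₆-cycles = develop rotate₅₁ 5 (
  (2 ∷ 8 ∷ 0 ∷ 6 ∷ 10 ∷ 5 ∷ 3 ∷ 7 ∷ 1 ∷ []) ∷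
  (0 ∷ 5 ∷ 6 ∷ 1 ∷ 10 ∷ 11 ∷ 4 ∷ 3 ∷ 8 ∷ []) ∷
  (5 ∷ 6 ∷ 8 ∷ 2 ∷ 9 ∷ 10 ∷ 1 ∷ 3 ∷ 11 ∷ []) ∷
  (9 ∷ 0 ∷ 1 ∷ 8 ∷ 3 ∷ 11 ∷ 10 ∷ 2 ∷ 7 ∷ []) ∷
  [])

crossing₆₉-cycles : List (TightCycle 9 15)
crossing₆₉-cycles = develop (rotate 3) 3 (
  (6 ∷ 13 ∷ 0 ∷ 7 ∷ 1 ∷ 5 ∷ 11 ∷ 14 ∷ 2 ∷ []) ∷
  (6 ∷ 7 ∷ 0 ∷ 2 ∷ 14 ∷ 8 ∷ 3 ∷ 13 ∷ 1 ∷ []) ∷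
  (6 ∷ 14 ∷ 0 ∷ 12 ∷ 4 ∷ 10 ∷ 7 ∷ 2 ∷ 3 ∷ []) ∷
  (8 ∷ 14 ∷ 0 ∷ 13 ∷ 12 ∷ 4 ∷ 2 ∷ 6 ∷ 5 ∷ []) ∷
  (13 ∷ 0 ∷ 1 ∷ 10 ∷ 4 ∷ 8 ∷ 2 ∷ 11 ∷ 3 ∷ []) ∷
  (8 ∷ 0 ∷ 7 ∷ 11 ∷ 2 ∷ 6 ∷ 9 ∷ 4 ∷ 13 ∷ []) ∷
  (0 ∷ 1 ∷ 6 ∷ 11 ∷ 3 ∷ 9 ∷ 5 ∷ 4 ∷ 14 ∷ []) ∷
  (0 ∷ 4 ∷ 13 ∷ 5 ∷ 10 ∷ 2 ∷ 1 ∷ 9 ∷ 11 ∷ []) ∷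
  (6 ∷ 11 ∷ 0 ∷ 14 ∷ 9 ∷ 5 ∷ 12 ∷ 8 ∷ 4 ∷ []) ∷
  (11 ∷ 13 ∷ 0 ∷ 10 ∷ 14 ∷ 3 ∷ 4 ∷ 7 ∷ 1 ∷ []) ∷
  (12 ∷ 0 ∷ 11 ∷ 5 ∷ 7 ∷ 4 ∷ 6 ∷ 1 ∷ 3 ∷ []) ∷
  (12 ∷ 3 ∷ 8 ∷ 4 ∷ 11 ∷ 9 ∷ 2 ∷ 5 ∷ 13 ∷ []) ∷
  (0 ∷ 9 ∷ 13 ∷ 3 ∷ 7 ∷ 11 ∷ 4 ∷ 10 ∷ 5 ∷ []) ∷
  [])

crossing₉₉-cycles : List (TightCycle 9 18)
crossing₉₉-cycles = develop (rotate 9) 9 (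
  (0 ∷ 9 ∷ 16 ∷ 1 ∷ 14 ∷ 4 ∷ 5 ∷ 15 ∷ 3 ∷ []) ∷
  (0 ∷ 10 ∷ 12 ∷ 8 ∷ 11 ∷ 14 ∷ 5 ∷ 3 ∷ 17 ∷ []) ∷
  (3 ∷ 12 ∷ 0 ∷ 4 ∷ 15 ∷ 7 ∷ 2 ∷ 11 ∷ 16 ∷ []) ∷
  (9 ∷ 11 ∷ 0 ∷ 12 ∷ 16 ∷ 1 ∷ 3 ∷ 17 ∷ 4 ∷ []) ∷
  (14 ∷ 0 ∷ 12 ∷ 8 ∷ 9 ∷ 15 ∷ 2 ∷ 4 ∷ 10 ∷ []) ∷
  (16 ∷ 0 ∷ 3 ∷ 14 ∷ 10 ∷ 2 ∷ 11 ∷ 4 ∷ 5 ∷ []) ∷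
  (0 ∷ 9 ∷ 12 ∷ 7 ∷ 13 ∷ 8 ∷ 4 ∷ 11 ∷ 10 ∷ []) ∷
  (10 ∷ 0 ∷ 4 ∷ 14 ∷ 7 ∷ 15 ∷ 9 ∷ 1 ∷ 2 ∷ []) ∷
  [])

complete₉-cycles : List (TightCycle 9 9)
complete₉-cycles = develop (rotate 3) 3 (
  (0 ∷ 1 ∷ 7 ∷ 6 ∷ 2 ∷ 5 ∷ 3 ∷ 8 ∷ 4 ∷ []) ∷
  (1 ∷ 8 ∷ 0 ∷ 5 ∷ 4 ∷ 2 ∷ 6 ∷ 3 ∷ 7 ∷ []) ∷
  (4 ∷ 7 ∷ 3 ∷ 8 ∷ 2 ∷ 5 ∷ 0 ∷ 1 ∷ 6 ∷ []) ∷
  [])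

complete₁₂-cycles : List (TightCycle 9 12)
complete₁₂-cycles = develop (rotate 3) 3 (
  (4 ∷ 5 ∷ 0 ∷ 7 ∷ 6 ∷ 2 ∷ 1 ∷ 8 ∷ 11 ∷ []) ∷
  (6 ∷ 8 ∷ 0 ∷ 11 ∷ 2 ∷ 1 ∷ 7 ∷ 9 ∷ 10 ∷ []) ∷
  (7 ∷ 9 ∷ 6 ∷ 4 ∷ 11 ∷ 0 ∷ 10 ∷ 5 ∷ 2 ∷ []) ∷
  (1 ∷ 11 ∷ 0 ∷ 5 ∷ 3 ∷ 2 ∷ 8 ∷ 4 ∷ 7 ∷ []) ∷
  (6 ∷ 9 ∷ 0 ∷ 7 ∷ 3 ∷ 5 ∷ 10 ∷ 4 ∷ 8 ∷ []) ∷
  (7 ∷ 11 ∷ 0 ∷ 9 ∷ 10 ∷ 5 ∷ 6 ∷ 3 ∷ 2 ∷ []) ∷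
  (10 ∷ 11 ∷ 6 ∷ 3 ∷ 8 ∷ 5 ∷ 0 ∷ 9 ∷ 4 ∷ []) ∷
  (3 ∷ 6 ∷ 10 ∷ 4 ∷ 1 ∷ 0 ∷ 5 ∷ 2 ∷ 9 ∷ []) ∷
  [])

complete₁₅-cycles : List (TightCycle 9 15)
-- 50 cycles are needed, again not a multiple of 3, so `σ` permutes the five triples of the 1-factor
-- cyclically instead of rotating inside each.
complete₁₅-cycles = develop (λ x → (x + 3) % 15) 5 (
  (10 ∷ 0 ∷ 2 ∷ 4 ∷ 13 ∷ 11 ∷ 12 ∷ 14 ∷ 8 ∷ []) ∷
  (14 ∷ 1 ∷ 8 ∷ 2 ∷ 5 ∷ 10 ∷ 4 ∷ 6 ∷ 11 ∷ []) ∷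
  (14 ∷ 1 ∷ 2 ∷ 13 ∷ 7 ∷ 4 ∷ 12 ∷ 0 ∷ 9 ∷ []) ∷
  (4 ∷ 1 ∷ 2 ∷ 9 ∷ 5 ∷ 6 ∷ 12 ∷ 13 ∷ 3 ∷ []) ∷
  (14 ∷ 1 ∷ 4 ∷ 11 ∷ 12 ∷ 9 ∷ 7 ∷ 6 ∷ 3 ∷ []) ∷
  (2 ∷ 10 ∷ 1 ∷ 3 ∷ 13 ∷ 6 ∷ 7 ∷ 11 ∷ 9 ∷ []) ∷
  (4 ∷ 7 ∷ 1 ∷ 12 ∷ 8 ∷ 11 ∷ 6 ∷ 9 ∷ 0 ∷ []) ∷
  (0 ∷ 1 ∷ 4 ∷ 8 ∷ 12 ∷ 3 ∷ 5 ∷ 10 ∷ 11 ∷ []) ∷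
  (2 ∷ 6 ∷ 0 ∷ 13 ∷ 9 ∷ 14 ∷ 4 ∷ 8 ∷ 11 ∷ []) ∷
  (5 ∷ 1 ∷ 2 ∷ 3 ∷ 8 ∷ 0 ∷ 4 ∷ 14 ∷ 6 ∷ []) ∷
  [])

-- Only the existence of these seven decompositions is used from here on; their cycles stay opaque.
abstract

  tripartite₃₃₃ : Decomposable (Transversal ⊤ (intervals (3 ∷ 3 ∷ 3 ∷ [])))
  tripartite₃₃₃ = verified _ tripartite-cycles

  crossing₆₆ : Decomposable (Transversal ⊤ (intervals (6 ∷ 6 ∷ [])))
  crossing₆₆ = verified _ crossing₆₆-cycles

  crossing₆₉ : Decomposable (Transversal ⊤ (intervals (6 ∷ 9 ∷ [])))
  crossing₆₉ = verified _ crossing₆₉-cycles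

  crossing₉₉ : Decomposable (Transversal ⊤ (intervals (9 ∷ 9 ∷ [])))
  crossing₉₉ = verified _ crossing₉₉-cycles

  complete₉ : Decomposable (Transversal ⊤ (List.map ∁ (intervals (replicate 3 3))))
  complete₉ = verified _ complete₉-cycles

  complete₁₂ : Decomposable (Transversal ⊤ (List.map ∁ (intervals (replicate 4 3))))
  complete₁₂ = verified _ complete₁₂-cycles

  complete₁₅ : Decomposable (Transversal ⊤ (List.map ∁ (intervals (replicate 5 3))))
  complete₁₅ = verified _ complete₁₅-cycles

-- Triples meeting three disjoint sets

∈-∪₃⁻ : ∀ {x} (A B C : Subset n) → x ∈ A ∪ B ∪ C → x ∈ A ⊎ x ∈ B ⊎ x ∈ C
∈-∪₃⁻ A B C x∈ with x∈p∪q⁻ A (B ∪ C) x∈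
... | inj₁ x∈A  = inj₁ x∈A
... | inj₂ x∈BC = inj₂ (x∈p∪q⁻ B C x∈BC)

∈-∪₃⁺ : ∀ {x} (A B C : Subset n) → x ∈ A ⊎ x ∈ B ⊎ x ∈ C → x ∈ A ∪ B ∪ C
∈-∪₃⁺ A B C (inj₁ x∈A)        = x∈p∪q⁺ (inj₁ x∈A)
∈-∪₃⁺ A B C (inj₂ (inj₁ x∈B)) = x∈p∪q⁺ (inj₂ (x∈p∪q⁺ (inj₁ x∈B)))
∈-∪₃⁺ A B C (inj₂ (inj₂ x∈C)) = x∈p∪q⁺ (inj₂ (x∈p∪q⁺ {p = B} (inj₂ x∈C)))

∪-monoˡ-⊆ : ∀ {A A′ : Subset n} B → A ⊆ A′ → A ∪ B ⊆ A′ ∪ B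
∪-monoˡ-⊆ {A = A} B A⊆A′ x∈ = [ (λ x∈A → x∈p∪q⁺ (inj₁ (A⊆A′ x∈A))) , (λ x∈B → x∈p∪q⁺ (inj₂ x∈B)) ]′ (x∈p∪q⁻ A B x∈)

∩-monoʳ-Nonempty : ∀ {e A A′ : Subset n} → A ⊆ A′ → Nonempty (e ∩ A) → Nonempty (e ∩ A′)
∩-monoʳ-Nonempty {e = e} {A} A⊆A′ (x , x∈) with x∈e , x∈A ← x∈p∩q⁻ e A x∈ = x , x∈p∩q⁺ (x∈e , A⊆A′ x∈A)

⊆-missˡ : ∀ {e A₁ A₂ B : Subset n} → e ⊆ (A₁ ∪ A₂) ∪ B → Empty (e ∩ A₁) → e ⊆ A₂ ∪ B
⊆-missˡ {A₁ = A₁} {A₂} {B} e⊆ ¬A₁ x∈e with x∈p∪q⁻ (A₁ ∪ A₂) B (e⊆ x∈e)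
... | inj₂ x∈B = x∈p∪q⁺ (inj₂ x∈B)
... | inj₁ x∈A with x∈p∪q⁻ A₁ A₂ x∈A
...   | inj₁ x∈A₁ = ⊥-elim (¬A₁ (_ , x∈p∩q⁺ (x∈e , x∈A₁)))
...   | inj₂ x∈A₂ = x∈p∪q⁺ (inj₁ x∈A₂)

⊆-missʳ : ∀ {e A₁ A₂ B : Subset n} → e ⊆ (A₁ ∪ A₂) ∪ B → Empty (e ∩ A₂) → e ⊆ A₁ ∪ B
⊆-missʳ {e = e} {A₁} {A₂} {B} e⊆ = ⊆-missˡ (subst (λ A → e ⊆ A ∪ B) (∪-comm A₁ A₂) e⊆)

meets-∪ : ∀ {e} (A₁ A₂ : Subset n) → Nonempty (e ∩ (A₁ ∪ A₂)) → Nonempty (e ∩ A₁) ⊎ Nonempty (e ∩ A₂)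
meets-∪ {e = e} A₁ A₂ (x , x∈) with x∈e , x∈A ← x∈p∩q⁻ e (A₁ ∪ A₂) x∈ with x∈p∪q⁻ A₁ A₂ x∈A
... | inj₁ x∈A₁ = inj₁ (x , x∈p∩q⁺ (x∈e , x∈A₁))
... | inj₂ x∈A₂ = inj₂ (x , x∈p∩q⁺ (x∈e , x∈A₂))

⊆⇒misses : ∀ {e A U : Subset n} → Disjoint A U → e ⊆ U → Empty (e ∩ A)
⊆⇒misses {e = e} {A} A∩U e⊆U (x , x∈) with x∈e , x∈A ← x∈p∩q⁻ e A x∈ = A∩U x∈A (e⊆U x∈e)

Disjoint-∪ʳ : ∀ {A B C : Subset n} → Disjoint A B → Disjoint A C → Disjoint A (B ∪ C)
Disjoint-∪ʳ {B = B} {C} AB AC x∈A x∈BC = [ AB x∈A , AC x∈A ]′ (x∈p∪q⁻ B C x∈BC)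

Disjoint-⊆ˡ : ∀ {A A′ B : Subset n} → A′ ⊆ A → Disjoint A B → Disjoint A′ B
Disjoint-⊆ˡ A′⊆A AB x∈A′ = AB (A′⊆A x∈A′)

Disjoint⇒≢ : ∀ {A B : Subset n} {x y} → Disjoint A B → x ∈ A → y ∈ B → x ≢ y
Disjoint⇒≢ AB x∈A y∈B refl = AB x∈A y∈B

Tripartite : (A B C : Subset n) → Hypergraph n
Tripartite A B C = Transversal (A ∪ B ∪ C) (A ∷ B ∷ C ∷ [])

Crosses : (A B : Subset n) → Hypergraph n
Crosses A B = Transversal (A ∪ B) (A ∷ B ∷ [])

-- `Tripartite-∪` and `Tripartite-extend` act on the first part only; cyclic shifts bring each of
-- the other parts to that place.
Tripartite-rotate : (A B C : Subset n) → Decomposable (Tripartite A B C) → Decomposable (Tripartite B C A)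
Tripartite-rotate A B C (Cs , D) = Cs , IsDecomposition-cong D
  (λ { e (size , e⊆ , a ∷ b ∷ c ∷ []) → size , (λ x∈e → ∈-∪₃⁺ B C A (left (∈-∪₃⁻ A B C (e⊆ x∈e)))) , b ∷ c ∷ a ∷ [] })
  (λ { e (size , e⊆ , b ∷ c ∷ a ∷ []) → size , (λ x∈e → ∈-∪₃⁺ A B C (right (∈-∪₃⁻ B C A (e⊆ x∈e)))) , a ∷ b ∷ c ∷ [] })
  where
  left : ∀ {X Y Z : Set} → X ⊎ Y ⊎ Z → Y ⊎ Z ⊎ X
  left (inj₁ x)        = inj₂ (inj₂ x)
  left (inj₂ (inj₁ y)) = inj₁ y
  left (inj₂ (inj₂ z)) = inj₂ (inj₁ z)
  right : ∀ {X Y Z : Set} → Y ⊎ Z ⊎ X → X ⊎ Y ⊎ Z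
  right (inj₁ y)        = inj₂ (inj₁ y)
  right (inj₂ (inj₁ z)) = inj₂ (inj₂ z)
  right (inj₂ (inj₂ x)) = inj₁ x

module _ {A₁ A₂ B C : Subset n} (A₁A₂ : Disjoint A₁ A₂) (AB : Disjoint (A₁ ∪ A₂) B) (AC : Disjoint (A₁ ∪ A₂) C)
         (BC : Disjoint B C) where

  private
    A₁⊆ : A₁ ⊆ A₁ ∪ A₂
    A₁⊆ = p⊆p∪q A₂

    A₂⊆ : A₂ ⊆ A₁ ∪ A₂
    A₂⊆ = q⊆p∪q A₁ A₂

  -- One vertex from each of four pairwise disjoint sets is one too many for a triple. This makes
  -- the two pieces in `Tripartite-∪` disjoint and also places a triple that meets one of `A₁`, `A₂`
  -- outside the other.
  Tripartite-not-both : ∀ {e} → ∣ e ∣ ≡ 3 → Nonempty (e ∩ A₁) → Nonempty (e ∩ A₂) → Nonempty (e ∩ B) →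
                        ¬ Nonempty (e ∩ C)
  Tripartite-not-both {e} size (w , w∈) (x , x∈) (y , y∈) (z , z∈)
    with w∈e , w∈A₁ ← x∈p∩q⁻ e A₁ w∈ | x∈e , x∈A₂ ← x∈p∩q⁻ e A₂ x∈
       | y∈e , y∈B ← x∈p∩q⁻ e B y∈ | z∈e , z∈C ← x∈p∩q⁻ e C z∈ =
    ∣e∣≡3⇒¬4 size w∈e x∈e y∈e z∈e (Disjoint⇒≢ A₁A₂ w∈A₁ x∈A₂)
      (Disjoint⇒≢ AB (A₁⊆ w∈A₁) y∈B) (Disjoint⇒≢ AC (A₁⊆ w∈A₁) z∈C)
      (Disjoint⇒≢ AB (A₂⊆ x∈A₂) y∈B) (Disjoint⇒≢ AC (A₂⊆ x∈A₂) z∈C) (Disjoint⇒≢ BC y∈B z∈C)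

  Tripartite-∪ : Decomposable (Tripartite A₁ B C) → Decomposable (Tripartite A₂ B C) →
                 Decomposable (Tripartite (A₁ ∪ A₂) B C)
  Tripartite-∪ (_ , D₁) (_ , D₂) = _ , IsDecomposition-++ D₁ D₂
    (λ { e (size , e⊆ , a ∷ b ∷ c ∷ []) → cases e size e⊆ b c (meets-∪ A₁ A₂ a) })
    (λ { e (size , e⊆ , a ∷ bc) → size , ∪-monoˡ-⊆ (B ∪ C) A₁⊆ ∘ e⊆ , ∩-monoʳ-Nonempty A₁⊆ a ∷ bc })
    (λ { e (size , e⊆ , a ∷ bc) → size , ∪-monoˡ-⊆ (B ∪ C) A₂⊆ ∘ e⊆ , ∩-monoʳ-Nonempty A₂⊆ a ∷ bc })
    (λ { e (size , _ , a₁ ∷ b ∷ c ∷ []) (_ , _ , a₂ ∷ _) → Tripartite-not-both size a₁ a₂ b c })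
    where
    cases : ∀ e → ∣ e ∣ ≡ 3 → e ⊆ (A₁ ∪ A₂) ∪ B ∪ C → Nonempty (e ∩ B) → Nonempty (e ∩ C) →
            Nonempty (e ∩ A₁) ⊎ Nonempty (e ∩ A₂) → Tripartite A₁ B C e ⊎ Tripartite A₂ B C e
    cases e size e⊆ b c (inj₁ a₁) =
      inj₁ (size , ⊆-missʳ e⊆ (λ a₂ → Tripartite-not-both size a₁ a₂ b c) , a₁ ∷ b ∷ c ∷ [])
    cases e size e⊆ b c (inj₂ a₂) =
      inj₂ (size , ⊆-missˡ e⊆ (λ a₁ → Tripartite-not-both size a₁ a₂ b c) , a₂ ∷ b ∷ c ∷ [])

∣p∣≡0⇒Empty : {p : Subset n} → ∣ p ∣ ≡ 0 → Empty p
∣p∣≡0⇒Empty {p = p} eq (x , x∈p) with () ← subst (_≤ 0) (∣⁅x⁆∣≡1 x)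
  (subst (∣ ⁅ x ⁆ ∣ ≤_) eq (p⊆q⇒∣p∣≤∣q∣ λ y∈ → subst (_∈ p) (sym (x∈⁅y⁆⇒x≡y x y∈)) x∈p))

Tripartite-extend : {B C : Subset n} → Disjoint B C →
  (∀ A → ∣ A ∣ ≡ 3 → Disjoint A B → Disjoint A C → Decomposable (Tripartite A B C)) →
  ∀ a A → ∣ A ∣ ≡ a * 3 → Disjoint A B → Disjoint A C → Decomposable (Tripartite A B C)
-- The recursion runs down to an empty `A`, which no triple can meet.
Tripartite-extend BC base zero A ∣A∣ AB AC = [] , record
  { within   = []
  ; disjoint = []
  ; covers   = λ { e (_ , _ , (x , x∈) ∷ _) → ⊥-elim (∣p∣≡0⇒Empty ∣A∣ (x , proj₂ (x∈p∩q⁻ e A x∈))) }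
  }
Tripartite-extend BC base (suc a) A ∣A∣ AB AC with A₁ , A₂ , refl , A₁A₂ , ∣A₁∣ , ∣A₂∣ ← split 3 A ∣A∣ =
  Tripartite-∪ A₁A₂ AB AC BC
    (base A₁ ∣A₁∣ (Disjoint-⊆ˡ (p⊆p∪q A₂) AB) (Disjoint-⊆ˡ (p⊆p∪q A₂) AC))
    (Tripartite-extend BC base a A₂ ∣A₂∣ (Disjoint-⊆ˡ (q⊆p∪q A₁ A₂) AB) (Disjoint-⊆ˡ (q⊆p∪q A₁ A₂) AC))

-- The parts are cut to size 3 one at a time, each level holding the other two fixed. Two rotations
-- undo the shift that brought the next part to the front. The inner `A`, `B`, `C` shadow the outer
-- ones and denote the pieces of size 3.
Tripartite-decomposable : ∀ a b c {A B C : Subset n} → ∣ A ∣ ≡ a * 3 → ∣ B ∣ ≡ b * 3 → ∣ C ∣ ≡ c * 3 →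
  Disjoint A B → Disjoint A C → Disjoint B C → Decomposable (Tripartite A B C)
Tripartite-decomposable {n} a b c {A} {B} {C} ∣A∣ ∣B∣ ∣C∣ AB AC BC =
  Tripartite-extend BC (λ A ∣A∣ AB AC →
    Tripartite-rotate C A B (Tripartite-rotate B C A (Tripartite-extend (Disjoint-sym AC) (λ B ∣B∣ BC BA →
      Tripartite-rotate A B C (Tripartite-rotate C A B (Tripartite-extend (Disjoint-sym BA) (λ C ∣C∣ CA CB →
        base ∣C∣ ∣A∣ ∣B∣ CA CB (Disjoint-sym BA))
      c C ∣C∣ (Disjoint-sym AC) (Disjoint-sym BC))))
    b B ∣B∣ BC (Disjoint-sym AB))))
  a A ∣A∣ AB AC
  where
  base : {A B C : Subset n} → ∣ A ∣ ≡ 3 → ∣ B ∣ ≡ 3 → ∣ C ∣ ≡ 3 →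
         Disjoint A B → Disjoint A C → Disjoint B C → Decomposable (Tripartite A B C)
  base {A} {B} {C} ∣A∣ ∣B∣ ∣C∣ AB AC BC =
    subst (λ U → Decomposable (Transversal U (A ∷ B ∷ C ∷ [])))
          (cong (λ D → A ∪ B ∪ D) (∪-identityʳ C))
          (meeting-blocks (cong₂ _∷_ ∣A∣ (cong₂ _∷_ ∣B∣ (cong (_∷ []) ∣C∣)))
                          ((AB ∷ AC ∷ []) ∷ (BC ∷ []) ∷ [] ∷ []) tripartite₃₃₃)

-- Triples crossing two disjoint sets

Crosses-swap : (A B : Subset n) → Decomposable (Crosses A B) → Decomposable (Crosses B A)
Crosses-swap A B (Cs , D) = Cs , IsDecomposition-cong D (swap A B) (swap B A)
  where
  swap : ∀ A B e → Crosses A B e → Crosses B A e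
  swap A B e (size , e⊆ , a ∷ b ∷ []) = size , subst (e ⊆_) (∪-comm A B) e⊆ , b ∷ a ∷ []

Crosses-∪ : ∀ {A₁ A₂ B : Subset n} → Disjoint A₁ A₂ → Disjoint (A₁ ∪ A₂) B →
  Decomposable (Crosses A₁ B) → Decomposable (Crosses A₂ B) → Decomposable (Tripartite A₁ A₂ B) →
  Decomposable (Crosses (A₁ ∪ A₂) B)
Crosses-∪ {n} {A₁} {A₂} {B} A₁A₂ AB (_ , D₁) (_ , D₂) (_ , D₃) =
  _ , IsDecomposition-++ D₁
        (IsDecomposition-++ D₂ D₃ (λ _ → id) (λ _ → inj₁) (λ _ → inj₂)
          (λ { e (_ , e⊆ , _) (_ , _ , a₁ ∷ _) → ⊆⇒misses A₁∩A₂B e⊆ a₁ }))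
        cover sub₁ sub₂ disj
  where
  A₁⊆ : A₁ ⊆ A₁ ∪ A₂
  A₁⊆ = p⊆p∪q A₂
  A₂⊆ : A₂ ⊆ A₁ ∪ A₂
  A₂⊆ = q⊆p∪q A₁ A₂
  A₁∩A₂B : Disjoint A₁ (A₂ ∪ B)
  A₁∩A₂B = Disjoint-∪ʳ A₁A₂ (Disjoint-⊆ˡ A₁⊆ AB)
  A₂∩A₁B : Disjoint A₂ (A₁ ∪ B)
  A₂∩A₁B = Disjoint-∪ʳ (Disjoint-sym A₁A₂) (Disjoint-⊆ˡ A₂⊆ AB)
  Rest : Hypergraph n
  Rest e = Crosses A₂ B e ⊎ Tripartite A₁ A₂ B e
  cover : ∀ e → Crosses (A₁ ∪ A₂) B e → Crosses A₁ B e ⊎ Rest e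
  cover e (size , e⊆ , a ∷ b ∷ []) with nonempty? (e ∩ A₁) | nonempty? (e ∩ A₂)
  ... | yes a₁ | yes a₂ = inj₂ (inj₂ (size , subst (e ⊆_) (∪-assoc A₁ A₂ B) e⊆ , a₁ ∷ a₂ ∷ b ∷ []))
  ... | yes a₁ | no ¬a₂ = inj₁ (size , ⊆-missʳ e⊆ ¬a₂ , a₁ ∷ b ∷ [])
  ... | no ¬a₁ | yes a₂ = inj₂ (inj₁ (size , ⊆-missˡ e⊆ ¬a₁ , a₂ ∷ b ∷ []))
  ... | no ¬a₁ | no ¬a₂ = ⊥-elim ([ ¬a₁ , ¬a₂ ]′ (meets-∪ A₁ A₂ a))
  sub₁ : ∀ e → Crosses A₁ B e → Crosses (A₁ ∪ A₂) B e
  sub₁ e (size , e⊆ , a ∷ b) = size , ∪-monoˡ-⊆ B A₁⊆ ∘ e⊆ , ∩-monoʳ-Nonempty A₁⊆ a ∷ b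
  sub₂ : ∀ e → Rest e → Crosses (A₁ ∪ A₂) B e
  sub₂ e (inj₁ (size , e⊆ , a ∷ b))      = size , ∪-monoˡ-⊆ B A₂⊆ ∘ e⊆ , ∩-monoʳ-Nonempty A₂⊆ a ∷ b
  sub₂ e (inj₂ (size , e⊆ , a₁ ∷ _ ∷ b)) =
    size , subst (e ⊆_) (sym (∪-assoc A₁ A₂ B)) e⊆ , ∩-monoʳ-Nonempty A₁⊆ a₁ ∷ b
  disj : ∀ e → Crosses A₁ B e → Rest e → Empty.⊥
  disj e (_ , e⊆ , _) (inj₁ (_ , _ , a₂ ∷ _))     = ⊆⇒misses A₂∩A₁B e⊆ a₂
  disj e (_ , e⊆ , _) (inj₂ (_ , _ , _ ∷ a₂ ∷ _)) = ⊆⇒misses A₂∩A₁B e⊆ a₂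

-- Adding sixes to 6 or 9 reaches every multiple of 3 from 6 on, whence the offset in `2 + a` and
-- two base cases. The size of `B` enters through the triples meeting `A₁`, `A₂` and `B` that each
-- cut creates.
Crosses-extend : ∀ b {B : Subset n} → ∣ B ∣ ≡ b * 3 →
  (∀ A → ∣ A ∣ ≡ 6 → Disjoint A B → Decomposable (Crosses A B)) →
  (∀ A → ∣ A ∣ ≡ 9 → Disjoint A B → Decomposable (Crosses A B)) →
  ∀ a A → ∣ A ∣ ≡ (2 + a) * 3 → Disjoint A B → Decomposable (Crosses A B)
Crosses-extend b ∣B∣ six nine 0 = six
Crosses-extend b ∣B∣ six nine 1 = nine
Crosses-extend b ∣B∣ six nine (suc (suc a)) A ∣A∣ AB
  with A₁ , A₂ , refl , A₁A₂ , ∣A₁∣ , ∣A₂∣ ← split 6 A ∣A∣ =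
  Crosses-∪ A₁A₂ AB (six A₁ ∣A₁∣ A₁B) (Crosses-extend b ∣B∣ six nine a A₂ ∣A₂∣ A₂B)
    (Tripartite-decomposable 2 (2 + a) b ∣A₁∣ ∣A₂∣ ∣B∣ A₁A₂ A₁B A₂B)
  where
  A₁B : Disjoint A₁ _
  A₁B = Disjoint-⊆ˡ (p⊆p∪q A₂) AB
  A₂B : Disjoint A₂ _
  A₂B = Disjoint-⊆ˡ (q⊆p∪q A₁ A₂) AB

-- First `A` is cut with `B` fixed, then `B` with a piece of `A` fixed. Of the four resulting size
-- pairs, 9+6 is 6+9 with the sides exchanged, so three explicit decompositions suffice.
Crosses-decomposable : ∀ a b {A B : Subset n} → ∣ A ∣ ≡ (2 + a) * 3 → ∣ B ∣ ≡ (2 + b) * 3 →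
                       Disjoint A B → Decomposable (Crosses A B)
Crosses-decomposable {n} a b {A} {B} ∣A∣ ∣B∣ AB = Crosses-extend (2 + b) ∣B∣
  (λ A ∣A∣ AB → Crosses-swap B A (Crosses-extend 2 ∣A∣
    (λ B ∣B∣ BA → base ∣B∣ ∣A∣ BA crossing₆₆)
    (λ B ∣B∣ BA → Crosses-swap A B (base ∣A∣ ∣B∣ (Disjoint-sym BA) crossing₆₉)) b B ∣B∣ (Disjoint-sym AB)))
  (λ A ∣A∣ AB → Crosses-swap B A (Crosses-extend 3 ∣A∣
    (λ B ∣B∣ BA → base ∣B∣ ∣A∣ BA crossing₆₉)
    (λ B ∣B∣ BA → base ∣B∣ ∣A∣ BA crossing₉₉) b B ∣B∣ (Disjoint-sym AB)))
  a A ∣A∣ AB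
  where
  base : ∀ {k l} {A B : Subset n} → ∣ A ∣ ≡ k → ∣ B ∣ ≡ l → Disjoint A B →
         Decomposable (Transversal ⊤ (intervals (k ∷ l ∷ []))) → Decomposable (Crosses A B)
  base {A = A} {B} ∣A∣ ∣B∣ AB D =
    subst (λ U → Decomposable (Transversal U (A ∷ B ∷ []))) (cong (A ∪_) (∪-identityʳ B))
          (meeting-blocks (cong₂ _∷_ ∣A∣ (cong (_∷ []) ∣B∣)) ((AB ∷ []) ∷ [] ∷ []) D)

-- Complete hypergraphs minus a 1-factor

K³-mono : ∀ {V W e : Subset n} → V ⊆ W → K³[ V ] e → K³[ W ] e
K³-mono V⊆W (e⊆V , size) = V⊆W ∘ e⊆V , size

∪-oneFactor : ∀ {A B : Subset n} {I J} → Disjoint A B → IsOneFactor A I → IsOneFactor B J → IsOneFactor (A ∪ B) (I ++ J)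
∪-oneFactor {A = A} {B} {I} {J} AB F G = record
  { triples  = Allₚ.++⁺ (All.map (K³-mono (p⊆p∪q B)) F.triples) (All.map (K³-mono (q⊆p∪q A B)) G.triples)
  ; size     = begin
      length (I ++ J) * 3          ≡⟨ cong (_* 3) (length-++ I) ⟩
      (length I + length J) * 3    ≡⟨ ℕ.*-distribʳ-+ 3 (length I) (length J) ⟩
      length I * 3 + length J * 3  ≡⟨ cong₂ _+_ F.size G.size ⟩
      ∣ A ∣ + ∣ B ∣                ≡⟨ ∣∪∣-disjoint A B AB ⟨
      ∣ A ∪ B ∣                    ∎
  ; disjoint = AllPairsₚ.++⁺ F.disjoint G.disjoint
      (All.map (λ (e⊆A , _) → All.map (λ (f⊆B , _) → Disjoint⇒Empty λ x∈e x∈f → AB (e⊆A x∈e) (f⊆B x∈f)) G.triples) F.triples)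
  ; covers   = λ x x∈ → [ Anyₚ.++⁺ˡ ∘ F.covers x , Anyₚ.++⁺ʳ I ∘ G.covers x ]′ (x∈p∪q⁻ A B x∈)
  }
  where
  open ≡-Reasoning
  module F = IsOneFactor F
  module G = IsOneFactor G

-- A triple in `A ∪ B` lies in `A`, lies in `B`, or crosses. Members of `I` and `J` lie on one side,
-- so deleting them leaves the crossing triples intact. This serves both the recursion on W and the
-- final 2-split.
∪-decomposition : ∀ {A B : Subset n} {I J} {Cs Ds Es : List (TightCycle 9 n)} →
  Disjoint A B → IsOneFactor A I → IsOneFactor B J →
  IsDecomposition (K³[ A ] ∖ I) Cs → IsDecomposition (K³[ B ] ∖ J) Ds → IsDecomposition (Crosses A B) Es →
  IsDecomposition (K³[ A ∪ B ] ∖ (I ++ J)) (Cs ++ Ds ++ Es)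
∪-decomposition {n} {A} {B} {I} {J} AB F G D₁ D₂ D₃ =
  IsDecomposition-++ D₁
    (IsDecomposition-++ D₂ D₃ (λ _ → id) (λ _ → inj₁) (λ _ → inj₂)
      (λ { e ((e⊆B , _) , _) (_ , _ , a ∷ _) → ⊆⇒misses AB e⊆B a }))
    cover sub₁ sub₂ disj
  where
  module F = IsOneFactor F
  module G = IsOneFactor G
  meets : ∀ {e V} → ∣ e ∣ ≡ 3 → e ⊆ V → Nonempty (e ∩ V)
  meets size e⊆V with x , x∈e ← ∣e∣≡3⇒Nonempty size = x , x∈p∩q⁺ (x∈e , e⊆V x∈e)
  ⊆A⇒missB : ∀ {e} → e ⊆ A → Empty (e ∩ B)
  ⊆A⇒missB = ⊆⇒misses (Disjoint-sym AB)
  Rest : Hypergraph n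
  Rest e = (K³[ B ] ∖ J) e ⊎ Crosses A B e
  cover : ∀ e → (K³[ A ∪ B ] ∖ (I ++ J)) e → (K³[ A ] ∖ I) e ⊎ Rest e
  cover e ((e⊆ , size) , e∉) with nonempty? (e ∩ A) | nonempty? (e ∩ B)
  ... | yes a | yes b = inj₂ (inj₂ (size , e⊆ , a ∷ b ∷ []))
  ... | _     | no ¬b = inj₁ (((λ x∈e → [ id , (λ x∈B → ⊥-elim (¬b (_ , x∈p∩q⁺ (x∈e , x∈B)))) ]′ (x∈p∪q⁻ A B (e⊆ x∈e))) , size)
                              , e∉ ∘ ∈-++⁺ˡ)
  ... | no ¬a | _     = inj₂ (inj₁ (((λ x∈e → [ (λ x∈A → ⊥-elim (¬a (_ , x∈p∩q⁺ (x∈e , x∈A)))) , id ]′ (x∈p∪q⁻ A B (e⊆ x∈e))) , size)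
                              , e∉ ∘ ∈-++⁺ʳ I))
  sub₁ : ∀ e → (K³[ A ] ∖ I) e → (K³[ A ∪ B ] ∖ (I ++ J)) e
  sub₁ e ((e⊆A , size) , e∉I) = (p⊆p∪q B ∘ e⊆A , size) , λ e∈ → [ e∉I , e∉J ]′ (∈-++⁻ I e∈)
    where
    e∉J : ¬ (e ∈ₗ J)
    e∉J e∈J = ⊆A⇒missB e⊆A (meets size (proj₁ (All.lookup G.triples e∈J)))
  sub₂ : ∀ e → Rest e → (K³[ A ∪ B ] ∖ (I ++ J)) e
  sub₂ e (inj₁ ((e⊆B , size) , e∉J)) = (q⊆p∪q A B ∘ e⊆B , size) , λ e∈ → [ e∉I , e∉J ]′ (∈-++⁻ I e∈)
    where
    e∉I : ¬ (e ∈ₗ I)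
    e∉I e∈I = ⊆⇒misses AB e⊆B (meets size (proj₁ (All.lookup F.triples e∈I)))
  sub₂ e (inj₂ (size , e⊆ , a ∷ b ∷ [])) = (e⊆ , size) , λ e∈ →
    [ (λ e∈I → ⊆A⇒missB (proj₁ (All.lookup F.triples e∈I)) b)
    , (λ e∈J → ⊆⇒misses AB (proj₁ (All.lookup G.triples e∈J)) a) ]′ (∈-++⁻ I e∈)
  disj : ∀ e → (K³[ A ] ∖ I) e → Rest e → Empty.⊥
  disj e ((e⊆A , size) , _) (inj₁ ((e⊆B , _) , _))      = ⊆A⇒missB e⊆A (meets size e⊆B)
  disj e ((e⊆A , _) , _)    (inj₂ (_ , _ , _ ∷ b ∷ [])) = ⊆A⇒missB e⊆A b

NearDecomposable : Subset n → Set
NearDecomposable V = ∃ λ I → IsOneFactor V I × Decomposable (K³[ V ] ∖ I)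

triples-partition : ∀ m (V : Subset n) → ∣ V ∣ ≡ m * 3 →
  ∃ λ Ps → List.map ∣_∣ Ps ≡ replicate m 3 × AllPairs Disjoint Ps × V ≡ ⋃ Ps
triples-partition zero    V ∣V∣ = [] , refl , [] , Empty-unique (∣p∣≡0⇒Empty ∣V∣)
triples-partition (suc m) V ∣V∣ with P , W , refl , PW , ∣P∣ , ∣W∣ ← split 3 V ∣V∣
  with Ps , sizes , ds , refl ← triples-partition m W ∣W∣ =
  P ∷ Ps , cong₂ _∷_ ∣P∣ sizes
  , All.tabulate (λ Q∈Ps x∈P x∈Q → PW x∈P (∈⋃⁺ (Any.map (λ { refl → x∈Q }) Q∈Ps))) ∷ ds , refl

module _ (m : ℕ) {Ps : List (Subset n)} (sizes : List.map ∣_∣ Ps ≡ replicate m 3) (ds : AllPairs Disjoint Ps) where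

  private
    all-3 : All (λ P → ∣ P ∣ ≡ 3) Ps
    all-3 = Allₚ.map⁻ (subst (All (_≡ 3)) (sym sizes) (Allₚ.replicate⁺ m refl))

    ⋃-size : ∀ {Qs : List (Subset n)} → All (λ P → ∣ P ∣ ≡ 3) Qs → AllPairs Disjoint Qs → length Qs * 3 ≡ ∣ ⋃ Qs ∣
    ⋃-size {[]}     []         []       = sym (∣⊥∣≡0 n)
    ⋃-size {P ∷ Qs} (∣P∣ ∷ qs) (d ∷ ds) =
      trans (cong₂ _+_ (sym ∣P∣) (⋃-size qs ds)) (sym (∣∪∣-disjoint P (⋃ Qs) (Disjoint-⋃ d)))

  partition-oneFactor : IsOneFactor (⋃ Ps) Ps
  partition-oneFactor = record
    { triples  = All.tabulate λ P∈Ps → (λ x∈P → ∈⋃⁺ (Any.map (λ { refl → x∈P }) P∈Ps)) , All.lookup all-3 P∈Ps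
    ; size     = ⋃-size all-3 ds
    ; disjoint = AllPairs.map {R = Disjoint} (λ d → Disjoint⇒Empty d) ds
    ; covers   = λ _ → ∈⋃⁻ Ps
    }

  partition-nearDecomposable : Decomposable (Transversal ⊤ (List.map ∁ (intervals (replicate m 3)))) →
                               NearDecomposable (⋃ Ps)
  partition-nearDecomposable D₀ with Cs , D ← avoiding-blocks sizes ds D₀ =
    Ps , partition-oneFactor , Cs , IsDecomposition-cong D to from
    where
    to : ∀ e → Transversal (⋃ Ps) (List.map ∁ Ps) e → (K³[ ⋃ Ps ] ∖ Ps) e
    to e (size , e⊆ , avoid) = (e⊆ , size) , λ e∈Ps → misses (All.lookup (Allₚ.map⁻ avoid) e∈Ps)
      where
      misses : ¬ Nonempty (e ∩ ∁ e)
      misses (x , x∈) with x∈e , x∈∁e ← x∈p∩q⁻ e (∁ e) x∈ = x∈∁p⇒x∉p x∈∁e x∈e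
    from : ∀ e → (K³[ ⋃ Ps ] ∖ Ps) e → Transversal (⋃ Ps) (List.map ∁ Ps) e
    from e ((e⊆ , size) , e∉Ps) = size , e⊆ , Allₚ.map⁺ (All.tabulate meets)
      where
      meets : ∀ {P} → P ∈ₗ Ps → Nonempty (e ∩ ∁ P)
      meets {P} P∈Ps with nonempty? (e ∩ ∁ P)
      ... | yes x  = x
      ... | no  ¬x = contradiction (subst (_∈ₗ Ps) (sym e≡P) P∈Ps) e∉Ps
        where
        -- Missing `∁ P` puts `e` inside `P`, and both have three elements.
        e≡P : e ≡ P
        e≡P = ⊆∧∣≡∣⇒≡ (λ x∈e → x∉∁p⇒x∈p (λ x∈∁P → ¬x (_ , x∈p∩q⁺ (x∈e , x∈∁P))))
                      (trans size (sym (All.lookup all-3 P∈Ps)))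

nearDecomposable : ∀ m (V : Subset n) → ∣ V ∣ ≡ (3 + m) * 3 → NearDecomposable V
nearDecomposable {n} = go
  where
  base : ∀ m → Decomposable (Transversal ⊤ (List.map ∁ (intervals (replicate m 3)))) →
         (V : Subset n) → ∣ V ∣ ≡ m * 3 → NearDecomposable V
  base m D V ∣V∣ with Ps , sizes , ds , refl ← triples-partition m V ∣V∣ = partition-nearDecomposable m sizes ds D
  go : ∀ m (V : Subset n) → ∣ V ∣ ≡ (3 + m) * 3 → NearDecomposable V
  go 0 = base 3 complete₉
  go 1 = base 4 complete₁₂
  go 2 = base 5 complete₁₅
  -- The remainder `B` again has at least 9 vertices. The arguments `1` and `1 + m` below count from
  -- the offset 2 in `Crosses-decomposable`: 9 is `(2 + 1) * 3` and `∣ B ∣` is `(2 + (1 + m)) * 3`.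
  go (suc (suc (suc m))) V ∣V∣ with A , B , refl , AB , ∣A∣ , ∣B∣ ← split 9 V ∣V∣
    with I , F , _ , D₁ ← go 0 A ∣A∣ | J , G , _ , D₂ ← go m B ∣B∣
       | _ , D₃ ← Crosses-decomposable 1 (1 + m) ∣A∣ ∣B∣ AB =
    I ++ J , ∪-oneFactor AB F G , _ , ∪-decomposition AB F G D₁ D₂ D₃

-- Assembly of the 2-split decomposition

-- The 2-split is one more union step, with equal halves: `∪-decomposition` delivers its cycles
-- already arranged as `Cs₁ ++ Cs₂ ++ Cs₁₂`, so the whole decomposition and its three constituents
-- come from the same lists and the required permutations are reflexive.
twoSplit : ∀ k v → v ≡ (3 + k) * 3 + (3 + k) * 3 → TwoSplitDecomposition 9 v
twoSplit k v v≡ with V₁ , V₂ , ⊤≡ , V₁V₂ , ∣V₁∣ , ∣V₂∣ ← split ((3 + k) * 3) (⊤ {v}) (trans (∣⊤∣≡n v) v≡)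
  with I₁ , F₁ , Cs₁ , D₁ ← nearDecomposable k V₁ ∣V₁∣
     | I₂ , F₂ , Cs₂ , D₂ ← nearDecomposable k V₂ ∣V₂∣
     | Cs₁₂ , D₁₂ ← Crosses-decomposable (1 + k) (1 + k) ∣V₁∣ ∣V₂∣ V₁V₂ = record
  { I         = I₁ ++ I₂
  ; I-factor  = subst (λ V → IsOneFactor V (I₁ ++ I₂)) (sym ⊤≡) (∪-oneFactor V₁V₂ F₁ F₂)
  ; cycles    = Cs₁ ++ Cs₂ ++ Cs₁₂
  ; decomp    = subst (λ V → IsDecomposition (K³[ V ] ∖ (I₁ ++ I₂)) (Cs₁ ++ Cs₂ ++ Cs₁₂)) (sym ⊤≡)
                      (∪-decomposition V₁V₂ F₁ F₂ D₁ D₂ D₁₂)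
  ; two-split = record
    { V₁ = V₁ ; V₂ = V₂
    ; V-cover     = sym ⊤≡
    ; V-disjoint  = Empty-unique (Disjoint⇒Empty V₁V₂)
    ; V₁-size     = trans ∣V₁∣ half
    ; V₂-size     = trans ∣V₂∣ half
    ; I₁ = I₁ ; I₂ = I₂
    ; I₁-factor   = F₁
    ; I₂-factor   = F₂
    ; I-split     = ↭-refl
    ; Cs₁ = Cs₁ ; Cs₂ = Cs₂ ; Cs₁₂ = Cs₁₂
    ; Cs₁-decomp  = D₁
    ; Cs₂-decomp  = D₂
    -- `Crosses` and `Crossing` differ by the condition `e ⊆ V₁ ∪ V₂`, which `⊤≡` supplies.
    ; Cs₁₂-decomp = IsDecomposition-cong D₁₂
        (λ { e (size , _ , a ∷ b ∷ []) → size , a , b })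
        (λ { e (size , a , b) → size , (λ _ → subst (_ ∈_) ⊤≡ ∈⊤) , a ∷ b ∷ [] })
    ; Cs-split    = ↭-refl
    }
  }
  where
  double : ∀ m → m + m ≡ m * 2
  double = solve-∀
  half : (3 + k) * 3 ≡ v / 2
  half = sym (trans (cong (_/ 2) (trans v≡ (double ((3 + k) * 3)))) (m*n/n≡m ((3 + k) * 3) 2))

theorem14 : (v : ℕ) → v % 6 ≡ 0 → 18 ≤ v → TwoSplitDecomposition 9 v
-- For v = 6m the halves have size 3m, which is `(3 + k) * 3` with k = m - 3. From `18 ≤ v` follows
-- 3 ≤ m, so the truncated subtraction is exact.
theorem14 v v%6≡0 18≤v = twoSplit (v / 6 ℕ.∸ 3) v (begin
  v                                ≡⟨ m≡m%n+[m/n]*n v 6 ⟩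
  v % 6 + v / 6 * 6                ≡⟨ cong (_+ v / 6 * 6) v%6≡0 ⟩
  v / 6 * 6                        ≡⟨ cong (_* 6) (ℕ.m+[n∸m]≡n (/-monoˡ-≤ 6 18≤v)) ⟨
  (3 + (v / 6 ℕ.∸ 3)) * 6          ≡⟨ six (3 + (v / 6 ℕ.∸ 3)) ⟩
  (3 + (v / 6 ℕ.∸ 3)) * 3 + (3 + (v / 6 ℕ.∸ 3)) * 3 ∎)
  where
  open ≡-Reasoning
  six : ∀ m → m * 6 ≡ m * 3 + m * 3
  six = solve-∀
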